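{- For all parameters $a,b,c,d,f,g,h,\ell,p,r,s,t,u,w$, one has, as formal power series in $z$, $$\mathcal C(z)=\sum_{n\ge 0}\sum_{\sigma\in\mathcal S_n} a^{\mathsf{ile}(\sigma)} b^{\mathsf{nile}(\sigma)} c^{\mathsf{ie}(\sigma)-\mathsf{ile}(\sigma)} d^{\mathsf{nie}(\sigma)-\mathsf{nile}(\sigma)} f^{\mathsf{ilae}(\sigma)} g^{\mathsf{nilae}(\sigma)} h^{\mathsf{iae}(\sigma)-\mathsf{ilae}(\sigma)} \ell^{\mathsf{niae}(\sigma)-\mathsf{nilae}(\sigma)}\, p^{\mathsf{exc}(\sigma)-\mathsf{le}(\sigma)} r^{\mathsf{aexc}(\sigma)-\mathsf{lae}(\sigma)} s^{\mathsf{le}(\sigma)} t^{\mathsf{lae}(\sigma)} u^{\mathsf{fp}(\sigma)} w^{\mathsf{iefp}(\sigma)} z^n .$$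
   Context: $[n]=\{1,\dots,n\}$ and $\mathcal S_n$ is the set of permutations of $[n]$ ($\mathcal S_0$ consists of the empty permutation). For $n\ge1$, $[n]_{x,y}:=\sum_{i=0}^{n-1}x^{n-1-i}y^{i}$, and $[0]_{x,y}:=0$; the convention $0^0=1$ is used. For real parameters $a,b,c,d,f,g,h,\ell,p,r,s,t,u,w$ (they may equally be regarded as indeterminates), $\mathcal C(z)=\mathcal C_{a,b,c,d,f,g,h,\ell,p,r,s,t,u,w}(z)$ is the formal power series in $z$ defined by the continued fraction $$\mathcal C(z)=\cfrac{1}{1-\alpha_0z-\cfrac{\beta_1z^2}{1-\alpha_1z-\cfrac{\beta_2z^2}{\ddots}}},\qquad \alpha_n=u\,w^n+s\,[n]_{a,b}+t\,[n]_{f,g}\ (n\ge 0),\quad \beta_n=p\,r\,[n]_{c,d}\,[n]_{h,\ell}\ (n\ge 1).$$ For $\sigma\in\mathcal S_n$ define (indices $i$, and ordered pairs $(i,j)$, range over $[n]$): - $\mathsf{exc}(\sigma)=\#\{i: i<\sigma(i)\}$, $\mathsf{fp}(\sigma)=\#\{i:i=\sigma(i)\}$, $\mathsf{aexc}(\sigma)=\#\{i: i>\sigma(i)\}$; - $\mathsf{le}(\sigma)=\#\{i:\sigma^{ -1}(i)<i<\sigma(i)\}$, $\mathsf{lae}(\sigma)=\#\{i:\sigma^{ -1}(i)>i>\sigma(i)\}$; - $\mathsf{ie}(\sigma)=\#\{(i,j): i<j<\sigma(j)<\sigma(i)\}$, $\mathsf{ile}(\sigma)=\#\{(i,j): i<j<\sigma(j)<\sigma(i),\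 \sigma^{ -1}(j)<j\}$; - $\mathsf{nie}(\sigma)=\#\{(i,j): i<j<\sigma(i)<\sigma(j)\}$, $\mathsf{nile}(\sigma)=\#\{(i,j): i<j<\sigma(i)<\sigma(j),\ \sigma^{ -1}(j)<j\}$; - $\mathsf{iae}(\sigma)=\#\{(i,j): j>i>\sigma(i)>\sigma(j)\}$, $\mathsf{ilae}(\sigma)=\#\{(i,j): j>i>\sigma(i)>\sigma(j),\ \sigma^{ -1}(i)>i\}$; - $\mathsf{niae}(\sigma)=\#\{(i,j): j>i>\sigma(j)>\sigma(i)\}$, $\mathsf{nilae}(\sigma)=\#\{(i,j): j>i>\sigma(j)>\sigma(i),\ \sigma^{ -1}(i)>i\}$; - $\mathsf{iefp}(\sigma)=\#\{(i,j): i<j=\sigma(j)<\sigma(i)\}$. -}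

module Defs where

open import Algebra.Bundles using (CommutativeRing)
import Algebra.Properties.Ring as RingProperties
import Algebra.Properties.Semiring.Exp as SemiringExp
import Algebra.Properties.Semiring.Sum as SemiringSum
open import Data.Fin.Base using (Fin; zero; suc; toℕ; punchIn)
import Data.Fin.Base as Fin
import Data.Fin.Properties as Fin
open import Data.Fin.Permutation as Perm
  using (Permutation′; _⟨$⟩ʳ_; _⟨$⟩ˡ_; insert; remove; insert-punchIn; insert-remove)
open import Data.List.Base
  using (List; []; _∷_; allFin; cartesianProduct; cartesianProductWith; filter; foldr; length; map)
open import Data.List.Membership.Propositional.Properties using (∈-allFin)
import Data.List.Membership.Setoid.Properties as Membership
open import Data.List.Relation.Unary.All using ([])
open import Data.List.Relation.Unary.AllPairs using ([]; _∷_)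
open import Data.List.Relation.Unary.Any using (here)
open import Data.List.Relation.Unary.Enumerates.Setoid using (IsEnumeration)
open import Data.List.Relation.Unary.Unique.Propositional.Properties using (allFin⁺)
open import Data.List.Relation.Unary.Unique.Setoid using (Unique)
import Data.List.Relation.Unary.Unique.Setoid.Properties as Unique
open import Data.Nat.Base as ℕ using (ℕ; zero; suc; _∸_; s≤s)
import Data.Nat.Properties as ℕ
open import Data.Product.Base using (_×_; _,_; uncurry)
open import Data.Vec.Functional using (Vector)
import Data.Vec.Functional as Vector
open import Function.Base using (_∘_)
open import Level using (0ℓ)
open import Relation.Binary.Bundles using (Setoid)
open import Relation.Binary.PropositionalEquality as ≡ using (_≡_)
import Relation.Binary.Reasoning.Setoid as SetoidReasoning
open import Relation.Nullary.Decidable using (Dec; _×-dec_)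
open import Relation.Unary using (Decidable)

Perm-setoid : ℕ → Setoid 0ℓ 0ℓ
Perm-setoid n = record
  { Carrier       = Permutation′ n
  ; _≈_           = Perm._≈_
  ; isEquivalence = record
    { refl  = λ _ → ≡.refl
    ; sym   = λ π≈ρ i → ≡.sym (π≈ρ i)
    ; trans = λ π≈ρ ρ≈τ i → ≡.trans (π≈ρ i) (ρ≈τ i)
    }
  }

-- A permutation of suc n elements is determined by the image j of zero and by
-- the permutation of n elements that remains once zero and j are removed.

permutations : ∀ n → List (Permutation′ n)
permutations zero    = Perm.id ∷ []
permutations (suc n) = cartesianProductWith (insert zero) (allFin (suc n)) (permutations n)

private
  insert-cong : ∀ {n} {j k : Fin (suc n)} {π ρ : Permutation′ n} →
                j ≡ k → π Perm.≈ ρ → insert zero j π Perm.≈ insert zero k ρ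
  insert-cong ≡.refl π≈ρ zero = ≡.refl
  insert-cong {j = j} {π = π} {ρ} ≡.refl π≈ρ (suc i) = begin
    insert zero j π ⟨$⟩ʳ suc i  ≡⟨ insert-punchIn zero j π i ⟩
    punchIn j (π ⟨$⟩ʳ i)        ≡⟨ ≡.cong (punchIn j) (π≈ρ i) ⟩
    punchIn j (ρ ⟨$⟩ʳ i)        ≡⟨ insert-punchIn zero j ρ i ⟨
    insert zero j ρ ⟨$⟩ʳ suc i  ∎
    where open ≡.≡-Reasoning

  insert-injective : ∀ {n} {j k : Fin (suc n)} {π ρ : Permutation′ n} →
                     insert zero j π Perm.≈ insert zero k ρ → j ≡ k × π Perm.≈ ρ
  insert-injective {j = j} {k} {π} {ρ} eq with eq zero
  ... | ≡.refl = ≡.refl , λ i → Fin.punchIn-injective j (π ⟨$⟩ʳ i) (ρ ⟨$⟩ʳ i) (begin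
    punchIn j (π ⟨$⟩ʳ i)        ≡⟨ insert-punchIn zero j π i ⟨
    insert zero j π ⟨$⟩ʳ suc i  ≡⟨ eq (suc i) ⟩
    insert zero j ρ ⟨$⟩ʳ suc i  ≡⟨ insert-punchIn zero j ρ i ⟩
    punchIn j (ρ ⟨$⟩ʳ i)        ∎)
    where open ≡.≡-Reasoning

permutations-complete : ∀ n → IsEnumeration (Perm-setoid n) (permutations n)
permutations-complete zero    π = here λ ()
permutations-complete (suc n) π = Membership.∈-resp-≈ (Perm-setoid (suc n))
  {x = insert zero (π ⟨$⟩ʳ zero) (remove zero π)} {π} (insert-remove zero π)
  (Membership.∈-cartesianProductWith⁺ (≡.setoid _) (Perm-setoid n) (Perm-setoid (suc n))
    (λ {j} {k} {π} {ρ} → insert-cong {j = j} {k} {π} {ρ})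
    (∈-allFin (π ⟨$⟩ʳ zero))
    (permutations-complete n (remove zero π)))

permutations-unique : ∀ n → Unique (Perm-setoid n) (permutations n)
permutations-unique zero    = [] ∷ []
permutations-unique (suc n) = Unique.cartesianProductWith⁺
  (≡.setoid _) (Perm-setoid n) (Perm-setoid (suc n)) (insert zero)
  (λ {j} {k} {π} {ρ} → insert-injective {j = j} {k} {π} {ρ})
  (allFin⁺ (suc n)) (permutations-unique n)

-- [n] = {1,…,n} is represented by Fin n.  The statistics depend only on the
-- order of the indices, so the shift by one does not matter.  Each of ile, nile,
-- ilae, nilae, le, lae counts a subset of what ie, nie, iae, niae, exc, aexc
-- respectively count, so truncated subtraction of the former from the latter is
-- exact.

count : ∀ {n} {P : Fin n → Set} → Decidable P → ℕ
count {n} P? = length (filter P? (allFin n))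

count₂ : ∀ {n} {P : Fin n → Fin n → Set} → (∀ i j → Dec (P i j)) → ℕ
count₂ {n} P? = length (filter (uncurry P?) (cartesianProduct (allFin n) (allFin n)))

module _ {n} (σ : Permutation′ n) where

  private
    infix 4 _<_ _≐_
    infixr 2 _&_

    _<_ : (i j : Fin n) → Dec (i Fin.< j)
    _<_ = Fin._<?_

    _≐_ : (i j : Fin n) → Dec (i ≡ j)
    _≐_ = Fin._≟_

    _&_ : ∀ {A B : Set} → Dec A → Dec B → Dec (A × B)
    _&_ = _×-dec_

    to from : Fin n → Fin n
    to   i = σ ⟨$⟩ʳ i
    from i = σ ⟨$⟩ˡ i

  exc fp aexc le lae : ℕ
  exc  = count λ i → i < to i
  fp   = count λ i → i ≐ to i
  aexc = count λ i → to i < i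
  le   = count λ i → from i < i & i < to i
  lae  = count λ i → to i < i & i < from i

  ie ile nie nile : ℕ
  ie   = count₂ λ i j → i < j & j < to j & to j < to i
  ile  = count₂ λ i j → (i < j & j < to j & to j < to i) & from j < j
  nie  = count₂ λ i j → i < j & j < to i & to i < to j
  nile = count₂ λ i j → (i < j & j < to i & to i < to j) & from j < j

  iae ilae niae nilae : ℕ
  iae   = count₂ λ i j → to j < to i & to i < i & i < j
  ilae  = count₂ λ i j → (to j < to i & to i < i & i < j) & i < from i
  niae  = count₂ λ i j → to i < to j & to j < i & i < j
  nilae = count₂ λ i j → (to i < to j & to j < i & i < j) & i < from i

  iefp : ℕ
  iefp = count₂ λ i j → i < j & j ≐ to j & to j < to i

module PowerSeries {κ κ′} (R : CommutativeRing κ κ′) where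

  open CommutativeRing R
  open RingProperties ring using (-0#≈0#)
  open SemiringExp semiring public using (_^_)
  open SemiringSum semiring public using (sum-syntax)
  open SemiringSum semiring using (sum-cong-≋)

  infixl 10 ∑∈-syntax

  ∑∈-syntax : ∀ {a} {A : Set a} → List A → (A → Carrier) → Carrier
  ∑∈-syntax xs f = foldr _+_ 0# (map f xs)

  syntax ∑∈-syntax xs (λ x → e) = ∑[ x ∈ xs ] e

  [_]⟨_,_⟩ : ℕ → Carrier → Carrier → Carrier
  [ n ]⟨ x , y ⟩ = ∑[ i < n ] (x ^ (n ∸ 1 ∸ toℕ i) * y ^ toℕ i)

  -- F n is the coefficient of zⁿ.

  Series : Set κ
  Series = ℕ → Carrier

  infix  4 _≋_
  infixl 6 _-ₛ_
  infixl 7 _*ₛ_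
  infixr 7 _•_
  infixr 8 z·_
  infix  9 _⁻¹

  _≋_ : Series → Series → Set κ′
  F ≋ G = ∀ n → F n ≈ G n

  1ₛ : Series
  1ₛ zero    = 1#
  1ₛ (suc _) = 0#

  _-ₛ_ : Series → Series → Series
  (F -ₛ G) n = F n - G n

  _*ₛ_ : Series → Series → Series
  (F *ₛ G) n = ∑[ i < suc n ] (F (toℕ i) * G (n ∸ toℕ i))

  _•_ : Carrier → Series → Series
  (x • F) n = x * F n

  z·_ : Series → Series
  (z· F) zero    = 0#
  (z· F) (suc n) = F n

  -- The inverse G of a series F with constant term 1 is given by G₀ = 1 and
  -- Gₙ₊₁ = - (F₁Gₙ + F₂Gₙ₋₁ + ⋯ + Fₙ₊₁G₀).  The recursion builds the vector
  -- Gₙ₋₁ ∷ ⋯ ∷ G₀ ∷ [] of earlier coefficients.  If the constant term of F is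
  -- not 1, then F ⁻¹ carries no meaning.

  private
    next : Series → ∀ n → Vector Carrier n → Carrier
    next F zero    _  = 1#
    next F (suc n) gs = - ∑[ i < suc n ] (F (suc (toℕ i)) * gs i)

    earlier : Series → ∀ n → Vector Carrier n
    earlier F zero    = Vector.[]
    earlier F (suc n) = next F n (earlier F n) Vector.∷ earlier F n

  _⁻¹ : Series → Series
  (F ⁻¹) n = next F n (earlier F n)

  private
    earlier-lookup : ∀ F n (i : Fin (suc n)) → earlier F (suc n) i ≡ (F ⁻¹) (n ∸ toℕ i)
    earlier-lookup F n       zero    = ≡.refl
    earlier-lookup F (suc n) (suc i) = earlier-lookup F n i

  ⁻¹-inverseʳ : ∀ F → F 0 ≈ 1# → F *ₛ F ⁻¹ ≋ 1ₛ
  ⁻¹-inverseʳ F F₀≈1 zero    = trans (+-identityʳ _) (trans (*-identityʳ _) F₀≈1)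
  ⁻¹-inverseʳ F F₀≈1 (suc n) = begin
    F 0 * (F ⁻¹) (suc n) + tail   ≈⟨ +-congʳ (*-congʳ F₀≈1) ⟩
    1# * (F ⁻¹) (suc n) + tail    ≈⟨ +-congʳ (*-identityˡ _) ⟩
    (F ⁻¹) (suc n) + tail         ≈⟨ +-congˡ (sum-cong-≋ λ i → *-congˡ {F (suc (toℕ i))} (reflexive (≡.sym (earlier-lookup F n i)))) ⟩
    - tail′ + tail′               ≈⟨ -‿inverseˡ tail′ ⟩
    0#                            ∎
    where
    open SetoidReasoning setoid
    tail tail′ : Carrier
    tail  = ∑[ i < suc n ] (F (suc (toℕ i)) * (F ⁻¹) (n ∸ toℕ i))
    tail′ = ∑[ i < suc n ] (F (suc (toℕ i)) * earlier F (suc n) i)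

  -- The truncation of depth N, in which the tail below level N is replaced by 0.

  denominator : Carrier → Carrier → Series → Series
  denominator a b K = 1ₛ -ₛ a • z· 1ₛ -ₛ b • z· z· K

  convergent : ℕ → (α β : ℕ → Carrier) → Series
  convergent zero    α β = λ _ → 0#
  convergent (suc N) α β = denominator (α 0) (β 1) (convergent N (α ∘ suc) (β ∘ suc)) ⁻¹

  -- 1/(1 - α₀z - β₁z²/(1 - α₁z - β₂z²/⋯)).  The value β 0 is not used.  The
  -- coefficient of zⁿ is the same in all truncations of depth greater than n.

  jFraction : (α β : ℕ → Carrier) → Series
  jFraction α β n = convergent (suc n) α β n

  private
    infix 4 _≋[_]_
    _≋[_]_ : Series → ℕ → Series → Set κ′
    F ≋[ n ] G = ∀ i → i ℕ.< n → F i ≈ G i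

    earlier-cong : ∀ {F G} n → F ≋[ n ] G → ∀ i → earlier F n i ≈ earlier G n i
    next-cong : ∀ {F G} n → F ≋[ suc n ] G → (F ⁻¹) n ≈ (G ⁻¹) n

    earlier-cong (suc n) F≋G zero    = next-cong n F≋G
    earlier-cong (suc n) F≋G (suc i) = earlier-cong n (λ k k<n → F≋G k (ℕ.m<n⇒m<1+n k<n)) i

    next-cong zero    F≋G = refl
    next-cong (suc n) F≋G = -‿cong (sum-cong-≋ λ i →
      *-cong (F≋G _ (s≤s (Fin.toℕ<n i)))
             (earlier-cong (suc n) (λ k k<n → F≋G k (ℕ.m<n⇒m<1+n k<n)) i))

    denominator-cong : ∀ {a b K L} n → K ≋[ n ] L →
                       denominator a b K ≋[ suc n ] denominator a b L
    denominator-cong n K≋L zero          i<n       = refl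
    denominator-cong n K≋L (suc zero)    i<n       = refl
    denominator-cong n K≋L (suc (suc i)) (s≤s i<n) =
      +-congˡ (-‿cong (*-congˡ (K≋L i (ℕ.<-trans (ℕ.n<1+n i) i<n))))

    step : ∀ {a b K L} n → K ≋[ n ] L → (denominator a b K ⁻¹) n ≈ (denominator a b L ⁻¹) n
    step n K≋L = next-cong n (denominator-cong n K≋L)

    convergent-stable : ∀ M N α β → M ℕ.≤ N → convergent M α β ≋[ M ] convergent N α β
    convergent-stable (suc M) (suc N) α β (s≤s M≤N) i (s≤s i≤M) = step i λ k k<i →
      convergent-stable M N (α ∘ suc) (β ∘ suc) M≤N k (ℕ.<-≤-trans k<i i≤M)

  jFraction-limit : ∀ α β n N → n ℕ.< N → convergent N α β n ≈ jFraction α β n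
  jFraction-limit α β n N n<N = sym (convergent-stable (suc n) N α β n<N n (ℕ.n<1+n n))

  jFraction-unfold : ∀ α β →
    jFraction α β ≋ denominator (α 0) (β 1) (jFraction (α ∘ suc) (β ∘ suc)) ⁻¹
  jFraction-unfold α β n = step n λ k k<n → jFraction-limit (α ∘ suc) (β ∘ suc) k n k<n

  denominator-constant : ∀ a b K → denominator a b K 0 ≈ 1#
  denominator-constant a b K = begin
    1# - a * 0# - b * 0#  ≈⟨ +-cong (+-congˡ (-‿cong (zeroʳ a))) (-‿cong (zeroʳ b)) ⟩
    1# - 0# - 0#          ≈⟨ +-cong (+-congˡ -0#≈0#) -0#≈0# ⟩
    1# + 0# + 0#          ≈⟨ trans (+-identityʳ _) (+-identityʳ _) ⟩
    1#                    ∎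
    where open SetoidReasoning setoid

{-# OPTIONS --safe #-}
module Submission where

-- The vertices 1, …, n of σ are processed from left to right.  Cutting σ before a
-- vertex leaves k vertices to the left whose preimage lies to the right, and k
-- vertices to the right whose preimage lies to the left; this number k is the
-- height of a Motzkin path.  An anti-excedance takes one of the k vertices on
-- the left as its image, whose rank among them gives the factor [k]_{f,g} or
-- [k]_{h,ℓ}.  The images of excedances are instead summed over the set of used
-- vertices to the right: a set of size k with an additional element is a set of
-- size k + 1 with a marked one, and the rank of the latter gives [k+1]_{c,d}, or
-- [k]_{a,b} if the current vertex was itself used.  Hence the sum over σ is the
-- weight of all Motzkin paths of length n, which is a coefficient of the fraction.

open import Algebra.Bundles using (CommutativeRing; Monoid)
import Algebra.Properties.CommutativeMonoid.Sum as CommutativeMonoidSum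
import Algebra.Properties.Monoid.Sum as MonoidSum
import Algebra.Properties.Ring as RingProperties
import Algebra.Properties.Semiring.Sum as SemiringSum
import Algebra.Solver.CommutativeMonoid as MonoidSolver
import Algebra.Solver.Ring.NaturalCoefficients.Default as SemiringSolver
open import Data.Bool.Base using (Bool; true; false; if_then_else_; not; _∧_)
import Data.Bool.Properties as Bool
open import Data.Fin.Base as Fin using (Fin; zero; suc; toℕ; punchIn)
open import Data.Fin.Permutation as Perm using (Permutation′; _⟨$⟩ʳ_; _⟨$⟩ˡ_; insert; insert-punchIn)
import Data.Fin.Properties as Fin
open import Data.Fin.Subset using (∣_∣)
open import Data.List.Base as List
  using (List; []; _∷_; _++_; allFin; cartesianProduct; cartesianProductWith; filter; foldr; length; tabulate)
open import Data.Nat.Base as ℕ using (ℕ; zero; suc; _∸_; _<ᵇ_)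
import Data.Nat.Properties as ℕ
open import Data.Product.Base using (_×_; _,_; uncurry)
open import Data.Sum.Base using (_⊎_; inj₁; inj₂)
import Data.Sum.Properties as Sum
open import Data.Vec.Base using (Vec; []; _∷_; lookup; replicate; _[_]≔_)
import Data.Vec.Properties as Vec
open import Defs
open import Function.Base using (_∘_; id)
open import Level using (_⊔_)
open import Relation.Binary.PropositionalEquality as ≡ using (_≡_; _≢_; _≗_)
import Relation.Binary.Reasoning.Setoid as SetoidReasoning
open import Relation.Nullary.Decidable using (Dec; does; yes; no; dec-true; dec-false)
open import Relation.Nullary.Negation using (contradiction)
open import Relation.Unary using (Decidable)

-- With both halves of the state fixed, the weight of all completions is not a function of the
-- height: it depends on where the used vertices lie on the right, since free vertices between two
-- consecutive used ones share a rank. Summing over all used sets of one size removes this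
-- dependence. On the left it never arises, because the k candidates have k different ranks. This
-- asymmetry shapes `∑-total`, which fixes `low` and sums over `high`; the sum over permutations is
-- recovered because height 0 admits only the empty set. The other obstacle is that the statistics
-- count pairs, whereas a step treats one vertex. Each pair is charged to the vertex k whose linking
-- selects the parameter, and its other vertex is seen only through its image y. Whether that other
-- vertex comes before or after k is then exactly the bit that the state stores at y.

module SeriesProperties {κ κ′} (R : CommutativeRing κ κ′) where

  open CommutativeRing R hiding (zero)
  open PowerSeries R
  open SemiringSum semiring using (sum-cong-≋; sum-replicate-zero; ∑-distrib-+; *-distribˡ-sum)
  open SetoidReasoning setoid
  open SemiringSolver commutativeSemiring using (solve; _:+_; _:*_; _:=_; con)

  -- Products of power series and the recursion for a J-fraction

  infixl 6 _+ₛ_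

  _+ₛ_ : Series → Series → Series
  (F +ₛ G) n = F n + G n

  *ₛ-cong : ∀ {F F′ G G′} → F ≋ F′ → G ≋ G′ → F *ₛ G ≋ F′ *ₛ G′
  *ₛ-cong F≋F′ G≋G′ n = sum-cong-≋ {suc n} λ i → *-cong (F≋F′ (toℕ i)) (G≋G′ (n ∸ toℕ i))

  *ₛ-distribʳ : ∀ H F G → (F +ₛ G) *ₛ H ≋ F *ₛ H +ₛ G *ₛ H
  *ₛ-distribʳ H F G n = trans
    (sum-cong-≋ {suc n} λ i → distribʳ (H (n ∸ toℕ i)) (F (toℕ i)) (G (toℕ i)))
    (∑-distrib-+ {suc n} (λ i → F (toℕ i) * H (n ∸ toℕ i)) (λ i → G (toℕ i) * H (n ∸ toℕ i)))

  •-*ₛ : ∀ x F G → (x • F) *ₛ G ≋ x • (F *ₛ G)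
  •-*ₛ x F G n = trans
    (sum-cong-≋ {suc n} λ i → *-assoc x (F (toℕ i)) (G (n ∸ toℕ i)))
    (sym (*-distribˡ-sum {suc n} x λ i → F (toℕ i) * G (n ∸ toℕ i)))

  z·-*ₛ : ∀ F G → (z· F) *ₛ G ≋ z· (F *ₛ G)
  z·-*ₛ F G zero    = trans (+-identityʳ _) (zeroˡ _)
  z·-*ₛ F G (suc n) = trans (+-congʳ (zeroˡ _)) (+-identityˡ _)

  z·-cong : ∀ {F G} → F ≋ G → z· F ≋ z· G
  z·-cong F≋G zero    = refl
  z·-cong F≋G (suc n) = F≋G n

  *ₛ-• : ∀ x F G → F *ₛ (x • G) ≋ x • (F *ₛ G)
  *ₛ-• x F G n = trans
    (sum-cong-≋ {suc n} λ i → solve 3 (λ x f g → f :* (x :* g) := x :* (f :* g)) refl x (F (toℕ i)) (G (n ∸ toℕ i)))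
    (sym (*-distribˡ-sum {suc n} x λ i → F (toℕ i) * G (n ∸ toℕ i)))

  *ₛ-z· : ∀ F G → F *ₛ (z· G) ≋ z· (F *ₛ G)
  *ₛ-z· F G zero          = trans (+-identityʳ _) (zeroʳ _)
  *ₛ-z· F G (suc zero)    = +-congˡ (*ₛ-z· (F ∘ suc) G zero)
  *ₛ-z· F G (suc (suc n)) = +-congˡ (*ₛ-z· (F ∘ suc) G (suc n))

  -- Induction on the coefficient: by computation, the shift of `F *ₛ G` is `F 0 • (G ∘ suc)` plus
  -- `(F ∘ suc) *ₛ G`.
  *ₛ-assoc : ∀ F G H → (F *ₛ G) *ₛ H ≋ F *ₛ (G *ₛ H)
  *ₛ-assoc F G H zero = solve 3 (λ f g h →
      (f :* g :+ con 0) :* h :+ con 0 := f :* (g :* h :+ con 0) :+ con 0)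
    refl (F 0) (G 0) (H 0)
  *ₛ-assoc F G H (suc n) = begin
    (F *ₛ G) 0 * H (suc n) + (((F *ₛ G) ∘ suc) *ₛ H) n
      ≈⟨ +-cong (*-congʳ (+-identityʳ _)) (trans (*ₛ-distribʳ H (F 0 • (G ∘ suc)) ((F ∘ suc) *ₛ G) n)
           (+-cong (•-*ₛ (F 0) (G ∘ suc) H n) (*ₛ-assoc (F ∘ suc) G H n))) ⟩
    F 0 * G 0 * H (suc n) + (F 0 * ((G ∘ suc) *ₛ H) n + ((F ∘ suc) *ₛ (G *ₛ H)) n)
      ≈⟨ solve 5 (λ f g h x y → f :* g :* h :+ (f :* x :+ y) := f :* (g :* h :+ x) :+ y)
           refl (F 0) (G 0) (H (suc n)) _ _ ⟩
    F 0 * (G *ₛ H) (suc n) + ((F ∘ suc) *ₛ (G *ₛ H)) n ∎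

  *ₛ-identityˡ : ∀ F → 1ₛ *ₛ F ≋ F
  *ₛ-identityˡ F zero    = trans (+-identityʳ _) (*-identityˡ _)
  *ₛ-identityˡ F (suc n) = begin
    1# * F (suc n) + ∑[ i < suc n ] (0# * F (n ∸ toℕ i))
      ≈⟨ +-cong (*-identityˡ _) (sum-cong-≋ {suc n} λ i → zeroˡ (F (n ∸ toℕ i))) ⟩
    F (suc n) + ∑[ i < suc n ] 0#
      ≈⟨ +-congˡ (sum-replicate-zero (suc n)) ⟩
    F (suc n) + 0#
      ≈⟨ +-identityʳ _ ⟩
    F (suc n) ∎

  -- Compare coefficients in `D *ₛ J ≋ 1ₛ`: the constant term of `D` is 1 and the rest of `D` is the
  -- negative of `E`. In terms of paths, a non-empty path at height 0 starts with a level step, or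
  -- with an up step whose first return splits it into a `K` part and a `J` part.
  jFraction-suc : ∀ α β → jFraction α β ∘ suc ≋
    α 0 • jFraction α β +ₛ z· (β 1 • (jFraction (α ∘ suc) (β ∘ suc) *ₛ jFraction α β))
  jFraction-suc α β n = begin
    J (suc n)                       ≈⟨ +-identityʳ _ ⟨
    J (suc n) + 0#                  ≈⟨ +-congˡ (-‿inverseˡ (X n)) ⟨
    J (suc n) + (- X n + X n)       ≈⟨ +-assoc _ _ _ ⟨
    J (suc n) + - X n + X n         ≈⟨ +-congʳ vanish ⟩
    0# + X n                        ≈⟨ +-identityˡ _ ⟩
    X n                             ∎
    where
    open RingProperties ring using (-‿+-comm; -1*x≈-x)
    K J D X E : Series
    K = jFraction (α ∘ suc) (β ∘ suc)
    J = jFraction α β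
    D = denominator (α 0) (β 1) K
    X = α 0 • J +ₛ z· (β 1 • (K *ₛ J))
    E = α 0 • 1ₛ +ₛ z· (β 1 • K)

    D-tail : D ∘ suc ≋ (- 1#) • E
    D-tail i = begin
      0# - α 0 * 1ₛ i - β 1 * (z· K) i      ≈⟨ +-assoc _ _ _ ⟩
      0# + (- (α 0 * 1ₛ i) - β 1 * (z· K) i) ≈⟨ +-identityˡ _ ⟩
      - (α 0 * 1ₛ i) - β 1 * (z· K) i       ≈⟨ -‿+-comm _ _ ⟩
      - (α 0 * 1ₛ i + β 1 * (z· K) i)       ≈⟨ -‿cong (+-congˡ (shift i)) ⟩
      - E i                                 ≈⟨ -1*x≈-x _ ⟨
      - 1# * E i                            ∎
      where
      shift : ∀ i → β 1 * (z· K) i ≈ (z· (β 1 • K)) i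
      shift zero    = zeroʳ (β 1)
      shift (suc i) = refl

    E*J : E *ₛ J ≋ X
    E*J n = trans (*ₛ-distribʳ J (α 0 • 1ₛ) (z· (β 1 • K)) n) (+-cong
      (trans (•-*ₛ (α 0) 1ₛ J n) (*-congˡ (*ₛ-identityˡ J n)))
      (trans (z·-*ₛ (β 1 • K) J n) (z·-cong (•-*ₛ (β 1) K J) n)))

    tail : ((D ∘ suc) *ₛ J) n ≈ - X n
    tail = begin
      ((D ∘ suc) *ₛ J) n        ≈⟨ *ₛ-cong {G = J} D-tail (λ _ → refl) n ⟩
      (((- 1#) • E) *ₛ J) n     ≈⟨ •-*ₛ (- 1#) E J n ⟩
      - 1# * (E *ₛ J) n         ≈⟨ -1*x≈-x _ ⟩
      - (E *ₛ J) n              ≈⟨ -‿cong (E*J n) ⟩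
      - X n                     ∎

    D₀≈1 : D 0 ≈ 1#
    D₀≈1 = denominator-constant (α 0) (β 1) K

    vanish : J (suc n) + - X n ≈ 0#
    vanish = begin
      J (suc n) + - X n                     ≈⟨ +-cong (trans (*-congʳ D₀≈1) (*-identityˡ _)) tail ⟨
      D 0 * J (suc n) + ((D ∘ suc) *ₛ J) n  ≈⟨ *ₛ-cong {D} {D} (λ _ → refl) (jFraction-unfold α β) (suc n) ⟩
      (D *ₛ D ⁻¹) (suc n)                   ≈⟨ ⁻¹-inverseʳ D D₀≈1 (suc n) ⟩
      0#                                    ∎

  -- In the first-visit decomposition a path that returns to its starting height is followed by a
  -- remainder, here `F`. Carrying it along lets the recursion act inside such products.
  jFraction-*ₛ-suc : ∀ α β F n →
    let J = jFraction α β; K = jFraction (α ∘ suc) (β ∘ suc) in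
    (J *ₛ F) (suc n) ≈ F (suc n) + (α 0 * (J *ₛ F) n + (z· (β 1 • (K *ₛ (J *ₛ F)))) n)
  jFraction-*ₛ-suc α β F n = +-cong (*-identityˡ _) (begin
    ((J ∘ suc) *ₛ F) n
      ≈⟨ *ₛ-cong {G = F} (jFraction-suc α β) (λ _ → refl) n ⟩
    ((α 0 • J +ₛ z· (β 1 • (K *ₛ J))) *ₛ F) n
      ≈⟨ *ₛ-distribʳ F (α 0 • J) (z· (β 1 • (K *ₛ J))) n ⟩
    ((α 0 • J) *ₛ F) n + ((z· (β 1 • (K *ₛ J))) *ₛ F) n
      ≈⟨ +-cong (•-*ₛ (α 0) J F n) (trans (z·-*ₛ (β 1 • (K *ₛ J)) F n) (z·-cong assoc n)) ⟩
    α 0 * (J *ₛ F) n + (z· (β 1 • (K *ₛ (J *ₛ F)))) n ∎)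
    where
    J K : Series
    J = jFraction α β
    K = jFraction (α ∘ suc) (β ∘ suc)

    assoc : (β 1 • (K *ₛ J)) *ₛ F ≋ β 1 • (K *ₛ (J *ₛ F))
    assoc n = trans (•-*ₛ (β 1) (K *ₛ J) F n) (*-congˡ (*ₛ-assoc K J F n))

  -- Weighted Motzkin paths and continued fractions

  module MotzkinPaths (level up down : ℕ → Carrier) where

    -- The total weight of the Motzkin paths of length n from height h to height 0,
    -- where a step is weighted by the height at which it starts.

    motzkin : ℕ → ℕ → Carrier
    motzkin zero    zero    = 1#
    motzkin zero    (suc h) = 0#
    motzkin (suc n) zero    = level 0 * motzkin n 0 + up 0 * motzkin n 1
    motzkin (suc n) (suc h) =
      level (suc h) * motzkin n (suc h) + up (suc h) * motzkin n (suc (suc h)) + down (suc h) * motzkin n h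

    -- The fraction sees an up step only together with the down step that later returns from it,
    -- hence only the product of their weights.
    module _ (β : ℕ → Carrier) (β-split : ∀ h → β (suc h) ≈ up h * down (suc h)) where

      private
        -- The tail of the fraction at level h, that is, the series of paths from height h back to h
        -- that never go below h.
        J : ℕ → (α β : ℕ → Carrier) → Series
        J zero    α β = jFraction α β
        J (suc h) α β = J h (α ∘ suc) (β ∘ suc)

        J-*ₛ-suc : ∀ h α β F n →
          (J h α β *ₛ F) (suc n) ≈
          F (suc n) + (α h * (J h α β *ₛ F) n + (z· (β (suc h) • (J (suc h) α β *ₛ (J h α β *ₛ F)))) n)
        J-*ₛ-suc zero    α β = jFraction-*ₛ-suc α β
        J-*ₛ-suc (suc h) α β = J-*ₛ-suc h (α ∘ suc) (β ∘ suc)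

        J-*ₛ-zero : ∀ h α β F → (J h α β *ₛ F) 0 ≈ F 0
        J-*ₛ-zero zero    α β F = trans (+-identityʳ _) (*-identityˡ _)
        J-*ₛ-zero (suc h) α β F = J-*ₛ-zero h (α ∘ suc) (β ∘ suc) F

        -- Decomposing a path from height h at its first visits to h - 1, …, 0.

        Q : ℕ → Series
        Q zero    = jFraction level β
        Q (suc h) = z· (down (suc h) • (J (suc h) level β *ₛ Q h))

        z·-split : ∀ h n →
          (z· (β (suc h) • (J (suc h) level β *ₛ Q h))) n ≈ up h * Q (suc h) n
        z·-split h zero    = sym (zeroʳ (up h))
        z·-split h (suc n) = trans (*-congʳ (β-split h)) (*-assoc _ _ _)

        motzkin≈Q : ∀ n h → motzkin n h ≈ Q h n
        motzkin≈Q zero    zero    = refl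
        motzkin≈Q zero    (suc h) = refl
        motzkin≈Q (suc n) zero    = begin
          level 0 * motzkin n 0 + up 0 * motzkin n 1
            ≈⟨ +-cong (*-congˡ (motzkin≈Q n 0)) (*-congˡ (motzkin≈Q n 1)) ⟩
          level 0 * Q 0 n + up 0 * Q 1 n
            ≈⟨ +-congˡ (z·-split 0 n) ⟨
          level 0 * Q 0 n + (z· (β 1 • (J 1 level β *ₛ Q 0))) n
            ≈⟨ jFraction-suc level β n ⟨
          Q 0 (suc n) ∎
        motzkin≈Q (suc n) (suc h) = begin
          level (suc h) * motzkin n (suc h) + up (suc h) * motzkin n (suc (suc h)) + down (suc h) * motzkin n h
            ≈⟨ +-cong (+-cong (*-congˡ (motzkin≈Q n (suc h))) (*-congˡ (motzkin≈Q n (suc (suc h)))))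
                      (*-congˡ (motzkin≈Q n h)) ⟩
          level (suc h) * Q (suc h) n + up (suc h) * Q (suc (suc h)) n + down (suc h) * Q h n
            ≈⟨ first-visit n ⟩
          Q (suc h) (suc n) ∎
          where
          P : Series
          P = J (suc h) level β *ₛ Q h

          -- All terms carry the factor `down (suc h)` of `Q (suc h)`. What remains is the recursion
          -- `J-*ₛ-suc` for `P`: the first step goes down at once, stays level, or goes up.
          first-visit : ∀ n →
            level (suc h) * Q (suc h) n + up (suc h) * Q (suc (suc h)) n + down (suc h) * Q h n ≈
            down (suc h) * P n
          first-visit zero = trans
            (solve 4 (λ l u d q → l :* con 0 :+ u :* con 0 :+ d :* q := d :* q)
               refl (level (suc h)) (up (suc h)) (down (suc h)) (Q h 0))
            (*-congˡ (sym (J-*ₛ-zero (suc h) level β (Q h))))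
          first-visit (suc n) = begin
            l * (d * P n) + up (suc h) * (down (suc (suc h)) * (J (suc (suc h)) level β *ₛ Q (suc h)) n) + d * Q h (suc n)
              ≈⟨ +-congʳ (+-congˡ (trans (*-congˡ (*-congˡ (*ₛ-z· J₂ (d • P) n))) (pull n))) ⟩
            l * (d * P n) + d * Y n + d * Q h (suc n)
              ≈⟨ solve 5 (λ l d p y q → l :* (d :* p) :+ d :* y :+ d :* q := d :* (q :+ (l :* p :+ y)))
                   refl l d (P n) (Y n) (Q h (suc n)) ⟩
            d * (Q h (suc n) + (l * P n + (z· (β (suc (suc h)) • (J (suc (suc h)) level β *ₛ P))) n))
              ≈⟨ *-congˡ (J-*ₛ-suc (suc h) level β (Q h) n) ⟨
            d * P (suc n) ∎
            where
            l = level (suc h)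
            d = down (suc h)
            J₂ Y : Series
            J₂ = J (suc (suc h)) level β
            Y = z· (β (suc (suc h)) • (J₂ *ₛ P))

            -- The factors `d` and z of `Q (suc h)` are moved out of the product with `J₂`, so that
            -- `up` meets the next `down` and `β-split` applies.
            pull : ∀ n → up (suc h) * (down (suc (suc h)) * (z· (J₂ *ₛ (d • P))) n) ≈ d * Y n
            pull zero    = trans (*-congˡ (zeroʳ _)) (trans (zeroʳ _) (sym (zeroʳ d)))
            pull (suc n) = begin
              up (suc h) * (down (suc (suc h)) * (J₂ *ₛ (d • P)) n)  ≈⟨ *-assoc _ _ _ ⟨
              up (suc h) * down (suc (suc h)) * (J₂ *ₛ (d • P)) n    ≈⟨ *-cong (sym (β-split (suc h))) (*ₛ-• d J₂ P n) ⟩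
              β (suc (suc h)) * (d * (J₂ *ₛ P) n)                    ≈⟨ solve 3 (λ b d x → b :* (d :* x) := d :* (b :* x)) refl _ _ _ ⟩
              d * (β (suc (suc h)) * (J₂ *ₛ P) n)                    ∎

      motzkin≈jFraction : ∀ n → motzkin n 0 ≈ jFraction level β n
      motzkin≈jFraction n = motzkin≈Q n 0

-- Subsets with a marked element and their ranks

module Selections {κ κ′} (R : CommutativeRing κ κ′) where

  open CommutativeRing R hiding (zero)
  open PowerSeries R
  open SemiringSum semiring using (sum-cong-≋; *-distribˡ-sum)
  open SetoidReasoning setoid
  open SemiringSolver commutativeSemiring using (solve; _:+_; _:*_; _:=_; con)

  -- The first of n + 1 elements has n elements after it, which gives `α ^ n`; each other one has
  -- the first before it, which gives `β`.
  [1+n]-split : ∀ n α β → [ suc n ]⟨ α , β ⟩ ≈ α ^ n + β * [ n ]⟨ α , β ⟩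
  [1+n]-split n α β = +-cong (*-identityʳ _) (trans
    (sum-cong-≋ {n} λ i → begin
      α ^ (n ∸ suc (toℕ i)) * (β * β ^ toℕ i)
        ≈⟨ *-congʳ (reflexive (≡.cong (α ^_) (ℕ.∸-+-assoc n 1 (toℕ i)))) ⟨
      α ^ (n ∸ 1 ∸ toℕ i) * (β * β ^ toℕ i)
        ≈⟨ solve 3 (λ x b y → x :* (b :* y) := b :* (x :* y)) refl _ _ _ ⟩
      β * (α ^ (n ∸ 1 ∸ toℕ i) * β ^ toℕ i) ∎)
    (sym (*-distribˡ-sum {n} β λ i → α ^ (n ∸ 1 ∸ toℕ i) * β ^ toℕ i)))

  -- The entry at i itself does not count, whether it is true or not.

  rank : Carrier → Carrier → ∀ {n} → Vec Bool n → Fin n → Carrier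
  rank α β (_ ∷ v) zero    = α ^ ∣ v ∣
  rank α β (x ∷ v) (suc i) = (if x then β else 1#) * rank α β v i

  ∣remove∣ : ∀ {n} (v : Vec Bool n) i → lookup v i ≡ true → suc ∣ v [ i ]≔ false ∣ ≡ ∣ v ∣
  ∣remove∣ (true  ∷ v) zero    _  = ≡.refl
  ∣remove∣ (true  ∷ v) (suc i) eq = ≡.cong suc (∣remove∣ v i eq)
  ∣remove∣ (false ∷ v) (suc i) eq = ∣remove∣ v i eq

  -- The elements of `v` have 0, 1, 2, ... elements of `v` before them, each number once, so their
  -- ranks are the terms of `[ ∣ v ∣ ]⟨ α , β ⟩`.
  ∑-rank : ∀ α β C {n} (v : Vec Bool n) (F : Fin n → Carrier) →
           (∀ i → lookup v i ≡ true → F i ≈ C) →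
           ∑[ i < n ] (if lookup v i then rank α β v i * F i else 0#) ≈ [ ∣ v ∣ ]⟨ α , β ⟩ * C
  ∑-rank α β C []      F F≈C = sym (zeroˡ C)
  ∑-rank α β C {suc n} (true ∷ v) F F≈C = begin
    α ^ ∣ v ∣ * F zero + ∑[ i < n ] (if lookup v i then β * rank α β v i * F (suc i) else 0#)
      ≈⟨ +-cong (*-congˡ (F≈C zero ≡.refl)) (sum-cong-≋ {n} λ i → pull i (lookup v i)) ⟩
    α ^ ∣ v ∣ * C + ∑[ i < n ] (β * (if lookup v i then rank α β v i * F (suc i) else 0#))
      ≈⟨ +-congˡ (*-distribˡ-sum {n} β _) ⟨
    α ^ ∣ v ∣ * C + β * ∑[ i < n ] (if lookup v i then rank α β v i * F (suc i) else 0#)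
      ≈⟨ +-congˡ (*-congˡ (∑-rank α β C v (F ∘ suc) (F≈C ∘ suc))) ⟩
    α ^ ∣ v ∣ * C + β * ([ ∣ v ∣ ]⟨ α , β ⟩ * C)
      ≈⟨ solve 4 (λ x b y c → x :* c :+ b :* (y :* c) := (x :+ b :* y) :* c) refl _ _ _ _ ⟩
    (α ^ ∣ v ∣ + β * [ ∣ v ∣ ]⟨ α , β ⟩) * C
      ≈⟨ *-congʳ ([1+n]-split ∣ v ∣ α β) ⟨
    [ suc ∣ v ∣ ]⟨ α , β ⟩ * C ∎
    where
    pull : ∀ i x → (if x then β * rank α β v i * F (suc i) else 0#) ≈
                   β * (if x then rank α β v i * F (suc i) else 0#)
    pull i true  = *-assoc _ _ _
    pull i false = sym (zeroʳ β)
  ∑-rank α β C {suc n} (false ∷ v) F F≈C = begin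
    0# + ∑[ i < n ] (if lookup v i then 1# * rank α β v i * F (suc i) else 0#)
      ≈⟨ +-identityˡ _ ⟩
    ∑[ i < n ] (if lookup v i then 1# * rank α β v i * F (suc i) else 0#)
      ≈⟨ sum-cong-≋ {n} (λ i → drop i (lookup v i)) ⟩
    ∑[ i < n ] (if lookup v i then rank α β v i * F (suc i) else 0#)
      ≈⟨ ∑-rank α β C v (F ∘ suc) (F≈C ∘ suc) ⟩
    [ ∣ v ∣ ]⟨ α , β ⟩ * C ∎
    where
    drop : ∀ i x → (if x then 1# * rank α β v i * F (suc i) else 0#) ≈
                   (if x then rank α β v i * F (suc i) else 0#)
    drop i true  = *-congʳ (*-identityˡ _)
    drop i false = refl

  -- The sum over the vectors with exactly k entries true.

  ∑⟨_,_⟩ : ∀ n → ℕ → (Vec Bool n → Carrier) → Carrier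
  ∑⟨ zero  , zero  ⟩ G = G []
  ∑⟨ zero  , suc k ⟩ G = 0#
  ∑⟨ suc n , zero  ⟩ G = ∑⟨ n , zero ⟩ (G ∘ (false ∷_))
  ∑⟨ suc n , suc k ⟩ G = ∑⟨ n , suc k ⟩ (G ∘ (false ∷_)) + ∑⟨ n , k ⟩ (G ∘ (true ∷_))

  ∑⟨⟩-cong : ∀ n k {F G : Vec Bool n → Carrier} → (∀ v → ∣ v ∣ ≡ k → F v ≈ G v) →
             ∑⟨ n , k ⟩ F ≈ ∑⟨ n , k ⟩ G
  ∑⟨⟩-cong zero    zero    F≈G = F≈G [] ≡.refl
  ∑⟨⟩-cong zero    (suc k) F≈G = refl
  ∑⟨⟩-cong (suc n) zero    F≈G = ∑⟨⟩-cong n zero λ v → F≈G (false ∷ v)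
  ∑⟨⟩-cong (suc n) (suc k) F≈G =
    +-cong (∑⟨⟩-cong n (suc k) λ v → F≈G (false ∷ v))
           (∑⟨⟩-cong n k λ v eq → F≈G (true ∷ v) (≡.cong suc eq))

  ∑⟨⟩-distrib-+ : ∀ n k (F G : Vec Bool n → Carrier) →
                  ∑⟨ n , k ⟩ (λ v → F v + G v) ≈ ∑⟨ n , k ⟩ F + ∑⟨ n , k ⟩ G
  ∑⟨⟩-distrib-+ zero    zero    F G = refl
  ∑⟨⟩-distrib-+ zero    (suc k) F G = sym (+-identityˡ 0#)
  ∑⟨⟩-distrib-+ (suc n) zero    F G = ∑⟨⟩-distrib-+ n zero (F ∘ (false ∷_)) (G ∘ (false ∷_))
  ∑⟨⟩-distrib-+ (suc n) (suc k) F G = trans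
    (+-cong (∑⟨⟩-distrib-+ n (suc k) (F ∘ (false ∷_)) (G ∘ (false ∷_)))
            (∑⟨⟩-distrib-+ n k (F ∘ (true ∷_)) (G ∘ (true ∷_))))
    (solve 4 (λ x y z t → (x :+ y) :+ (z :+ t) := (x :+ z) :+ (y :+ t)) refl _ _ _ _)

  *-distribˡ-∑⟨⟩ : ∀ n k x (G : Vec Bool n → Carrier) →
                   ∑⟨ n , k ⟩ (λ v → x * G v) ≈ x * ∑⟨ n , k ⟩ G
  *-distribˡ-∑⟨⟩ zero    zero    x G = refl
  *-distribˡ-∑⟨⟩ zero    (suc k) x G = sym (zeroʳ x)
  *-distribˡ-∑⟨⟩ (suc n) zero    x G = *-distribˡ-∑⟨⟩ n zero x (G ∘ (false ∷_))
  *-distribˡ-∑⟨⟩ (suc n) (suc k) x G = trans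
    (+-cong (*-distribˡ-∑⟨⟩ n (suc k) x (G ∘ (false ∷_))) (*-distribˡ-∑⟨⟩ n k x (G ∘ (true ∷_))))
    (sym (distribˡ x _ _))

  ∑⟨⟩-zero : ∀ n k → ∑⟨ n , k ⟩ (λ _ → 0#) ≈ 0#
  ∑⟨⟩-zero zero    zero    = refl
  ∑⟨⟩-zero zero    (suc k) = refl
  ∑⟨⟩-zero (suc n) zero    = ∑⟨⟩-zero n zero
  ∑⟨⟩-zero (suc n) (suc k) = trans (+-cong (∑⟨⟩-zero n (suc k)) (∑⟨⟩-zero n k)) (+-identityˡ 0#)

  ∑⟨⟩-comm : ∀ n k l (F : Vec Bool n → Fin l → Carrier) →
             ∑⟨ n , k ⟩ (λ v → ∑[ i < l ] F v i) ≈ ∑[ i < l ] ∑⟨ n , k ⟩ (λ v → F v i)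
  ∑⟨⟩-comm n k zero    F = ∑⟨⟩-zero n k
  ∑⟨⟩-comm n k (suc l) F = trans
    (∑⟨⟩-distrib-+ n k (λ v → F v zero) (λ v → ∑[ i < l ] F v (suc i)))
    (+-congˡ (∑⟨⟩-comm n k l (λ v → F v ∘ suc)))

  -- Double counting: a set of size k + 1 with a marked element is a set of size k
  -- with an element outside of it.

  ∑⟨⟩-insert : ∀ α β n k (G : Vec Bool n → Carrier) →
    ∑⟨ n , k ⟩ (λ v → ∑[ i < n ] (if lookup v i then 0# else rank α β v i * G (v [ i ]≔ true))) ≈
    [ suc k ]⟨ α , β ⟩ * ∑⟨ n , suc k ⟩ G
  ∑⟨⟩-insert α β zero    zero    G = sym (zeroʳ _)
  ∑⟨⟩-insert α β zero    (suc k) G = sym (zeroʳ _)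
  ∑⟨⟩-insert α β (suc n) k G = goal k
    where
    inner : (Vec Bool n → Carrier) → Vec Bool n → Carrier
    inner H v = ∑[ i < n ] (if lookup v i then 0# else rank α β v i * H (v [ i ]≔ true))

    scale : ∀ x (H : Vec Bool n → Carrier) v →
      ∑[ i < n ] (if lookup v i then 0# else x * rank α β v i * H (v [ i ]≔ true)) ≈ x * inner H v
    scale x H v = trans (sum-cong-≋ {n} λ i → pull i (lookup v i)) (sym (*-distribˡ-sum {n} x _))
      where
      pull : ∀ i y → (if y then 0# else x * rank α β v i * H (v [ i ]≔ true)) ≈
                     x * (if y then 0# else rank α β v i * H (v [ i ]≔ true))
      pull i true  = sym (zeroʳ x)
      pull i false = *-assoc _ _ _

    G₀ G₁ : Vec Bool n → Carrier
    G₀ = G ∘ (false ∷_)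
    G₁ = G ∘ (true ∷_)

    -- The head is not in the set: the new element is the head, with all k elements after it, or it
    -- lies in the tail.
    outside : ∀ k →
      ∑⟨ n , k ⟩ (λ v → α ^ ∣ v ∣ * G₁ v + ∑[ i < n ] (if lookup v i then 0# else 1# * rank α β v i * G₀ (v [ i ]≔ true))) ≈
      α ^ k * ∑⟨ n , k ⟩ G₁ + [ suc k ]⟨ α , β ⟩ * ∑⟨ n , suc k ⟩ G₀
    outside k = begin
      ∑⟨ n , k ⟩ (λ v → α ^ ∣ v ∣ * G₁ v + ∑[ i < n ] (if lookup v i then 0# else 1# * rank α β v i * G₀ (v [ i ]≔ true)))
        ≈⟨ ∑⟨⟩-cong n k (λ v eq → +-cong (*-congʳ (reflexive (≡.cong (α ^_) eq))) (trans (scale 1# G₀ v) (*-identityˡ _))) ⟩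
      ∑⟨ n , k ⟩ (λ v → α ^ k * G₁ v + inner G₀ v)
        ≈⟨ ∑⟨⟩-distrib-+ n k (λ v → α ^ k * G₁ v) (inner G₀) ⟩
      ∑⟨ n , k ⟩ (λ v → α ^ k * G₁ v) + ∑⟨ n , k ⟩ (inner G₀)
        ≈⟨ +-cong (*-distribˡ-∑⟨⟩ n k (α ^ k) G₁) (∑⟨⟩-insert α β n k G₀) ⟩
      α ^ k * ∑⟨ n , k ⟩ G₁ + [ suc k ]⟨ α , β ⟩ * ∑⟨ n , suc k ⟩ G₀ ∎

    -- The head is in the set and precedes every possible new element, so each rank has the factor
    -- `β`.
    inside : ∀ k →
      ∑⟨ n , k ⟩ (λ v → 0# + ∑[ i < n ] (if lookup v i then 0# else β * rank α β v i * G₁ (v [ i ]≔ true))) ≈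
      β * ([ suc k ]⟨ α , β ⟩ * ∑⟨ n , suc k ⟩ G₁)
    inside k = begin
      ∑⟨ n , k ⟩ (λ v → 0# + ∑[ i < n ] (if lookup v i then 0# else β * rank α β v i * G₁ (v [ i ]≔ true)))
        ≈⟨ ∑⟨⟩-cong n k (λ v _ → trans (+-identityˡ _) (scale β G₁ v)) ⟩
      ∑⟨ n , k ⟩ (λ v → β * inner G₁ v)
        ≈⟨ *-distribˡ-∑⟨⟩ n k β (inner G₁) ⟩
      β * ∑⟨ n , k ⟩ (inner G₁)
        ≈⟨ *-congˡ (∑⟨⟩-insert α β n k G₁) ⟩
      β * ([ suc k ]⟨ α , β ⟩ * ∑⟨ n , suc k ⟩ G₁) ∎

    goal : ∀ k →
      ∑⟨ suc n , k ⟩ (λ v → ∑[ i < suc n ] (if lookup v i then 0# else rank α β v i * G (v [ i ]≔ true))) ≈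
      [ suc k ]⟨ α , β ⟩ * ∑⟨ suc n , suc k ⟩ G
    -- The empty set does not contain the head, so only `outside` contributes.
    goal zero = begin
      _ ≈⟨ outside 0 ⟩
      1# * ∑⟨ n , 0 ⟩ G₁ + [ 1 ]⟨ α , β ⟩ * ∑⟨ n , 1 ⟩ G₀
        ≈⟨ solve 2 (λ x y → con 1 :* x :+ (con 1 :* con 1 :+ con 0) :* y := (con 1 :* con 1 :+ con 0) :* (y :+ x)) refl _ _ ⟩
      [ 1 ]⟨ α , β ⟩ * (∑⟨ n , 1 ⟩ G₀ + ∑⟨ n , 0 ⟩ G₁) ∎
    goal (suc k) = begin
      _ ≈⟨ +-cong (outside (suc k)) (inside k) ⟩
      α ^ suc k * ∑⟨ n , suc k ⟩ G₁ + [ suc (suc k) ]⟨ α , β ⟩ * ∑⟨ n , suc (suc k) ⟩ G₀ + β * ([ suc k ]⟨ α , β ⟩ * ∑⟨ n , suc k ⟩ G₁)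
        ≈⟨ solve 6 (λ x g₁ q g₀ b y → x :* g₁ :+ q :* g₀ :+ b :* (y :* g₁) := q :* g₀ :+ (x :+ b :* y) :* g₁) refl
             _ _ _ _ _ _ ⟩
      -- Sets of size k + 2 that contain the head arise in both cases, by adding the head or by
      -- adding a later element; `[1+n]-split` merges the two coefficients.
      [ suc (suc k) ]⟨ α , β ⟩ * ∑⟨ n , suc (suc k) ⟩ G₀ + (α ^ suc k + β * [ suc k ]⟨ α , β ⟩) * ∑⟨ n , suc k ⟩ G₁
        ≈⟨ +-congˡ (*-congʳ ([1+n]-split (suc k) α β)) ⟨
      [ suc (suc k) ]⟨ α , β ⟩ * ∑⟨ n , suc (suc k) ⟩ G₀ + [ suc (suc k) ]⟨ α , β ⟩ * ∑⟨ n , suc k ⟩ G₁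
        ≈⟨ distribˡ _ _ _ ⟨
      [ suc (suc k) ]⟨ α , β ⟩ * (∑⟨ n , suc (suc k) ⟩ G₀ + ∑⟨ n , suc k ⟩ G₁) ∎

-- When the vertices are processed from left to right, the current state consists
-- of the l processed vertices, last one first, each marked true if it is still
-- available as an image, and of the m other vertices, each marked true if it is
-- no longer available.

State : ℕ → ℕ → Set
State l m = Vec Bool l × Vec Bool m

Vertex : ℕ → ℕ → Set
Vertex l m = Fin l ⊎ Fin m

available : ∀ {l m} → State l m → Vertex l m → Bool
available (low , high) (inj₁ i) = lookup low i
available (low , high) (inj₂ i) = not (lookup high i)

choose : ∀ {l m} → State l (suc m) → Vertex l (suc m) → State (suc l) m
choose (low , x ∷ high) (inj₁ i)       = not x ∷ low [ i ]≔ false , high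
choose (low , x ∷ high) (inj₂ zero)    = false ∷ low , high
choose (low , x ∷ high) (inj₂ (suc i)) = not x ∷ low , high [ i ]≔ true

-- Choices of images and the passage to Motzkin paths

module Histories {κ κ′} (R : CommutativeRing κ κ′)
  (a b c d f g h ℓ p r s t u w : CommutativeRing.Carrier R) where

  open CommutativeRing R hiding (zero)
  open PowerSeries R
  open SeriesProperties R
  open Selections R
  open SemiringSum semiring using (sum-cong-≋; *-distribˡ-sum)
  open SetoidReasoning setoid
  open SemiringSolver commutativeSemiring using (solve; _:+_; _:*_; _:=_; con)

  level up down : ℕ → Carrier
  level n = u * w ^ n + s * [ n ]⟨ a , b ⟩ + t * [ n ]⟨ f , g ⟩
  up    n = p * [ suc n ]⟨ c , d ⟩
  down  n = r * [ n ]⟨ h , ℓ ⟩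

  open MotzkinPaths level up down

  -- A head `true` means that the preimage of the current vertex is smaller: an excedance is then
  -- linked (`s`), an anti-excedance is not (`r`). With `false` it is the other way round (`p`,
  -- `t`). Since `low` is reversed, both halves are read outwards from the current vertex, and one
  -- `rank` serves both: the counted vertices nearer than the image give its second parameter, those
  -- beyond it the first.
  weight : ∀ {l m} → State l (suc m) → Vertex l (suc m) → Carrier
  weight (low , true  ∷ high) (inj₁ i)       = r * rank h ℓ low i
  weight (low , false ∷ high) (inj₁ i)       = t * rank f g low i
  weight (low , x     ∷ high) (inj₂ zero)    = u * w ^ ∣ high ∣
  weight (low , true  ∷ high) (inj₂ (suc i)) = s * rank a b high i
  weight (low , false ∷ high) (inj₂ (suc i)) = p * rank c d high i

  ∑ᵥ : ∀ {l m} → (Vertex l m → Carrier) → Carrier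
  ∑ᵥ {l} {m} F = ∑[ i < l ] F (inj₁ i) + ∑[ i < m ] F (inj₂ i)

  total : ∀ m {l} → State l m → Carrier
  -- States with vertices left over also get the value 1. They drop out in `∑-total`, since no
  -- vector of length 0 has a true entry.
  total zero    S = 1#
  total (suc m) S = ∑ᵥ λ z → if available S z then weight S z * total m (choose S z) else 0#

  private
    swap-if : ∀ x (y z : Carrier) → (if not x then y else z) ≈ (if x then z else y)
    swap-if true  _ _ = refl
    swap-if false _ _ = refl

    factor : ∀ {n} x (y : Fin n → Bool) (F G : Fin n → Carrier) →
      ∑[ i < n ] (if y i then x * F i * G i else 0#) ≈ x * ∑[ i < n ] (if y i then F i * G i else 0#)
    factor {n} x y F G = trans (sum-cong-≋ {n} λ i → pull i (y i)) (sym (*-distribˡ-sum {n} x _))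
      where
      pull : ∀ i z → (if z then x * F i * G i else 0#) ≈ x * (if z then F i * G i else 0#)
      pull i true  = *-assoc x _ _
      pull i false = sym (zeroʳ x)

    -- The contribution of the images to the right of the current vertex.

    right : ∀ m k {l} (low : Vec Bool l) x y α β →
      ∑⟨ m , k ⟩ (λ v → ∑[ i < m ]
        (if not (lookup v i) then y * rank α β v i * total m (x ∷ low , v [ i ]≔ true) else 0#)) ≈
      y * ([ suc k ]⟨ α , β ⟩ * ∑⟨ m , suc k ⟩ (λ v → total m (x ∷ low , v)))
    right m k low x y α β = begin
      _ ≈⟨ ∑⟨⟩-cong m k (λ v _ → trans
             (factor y (not ∘ lookup v) (rank α β v) (λ i → total m (x ∷ low , v [ i ]≔ true)))
             (*-congˡ (sum-cong-≋ {m} λ i → swap-if (lookup v i) _ _))) ⟩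
      ∑⟨ m , k ⟩ (λ v → y * ∑[ i < m ] (if lookup v i then 0# else rank α β v i * total m (x ∷ low , v [ i ]≔ true)))
        ≈⟨ *-distribˡ-∑⟨⟩ m k y _ ⟩
      y * ∑⟨ m , k ⟩ (λ v → ∑[ i < m ] (if lookup v i then 0# else rank α β v i * total m (x ∷ low , v [ i ]≔ true)))
        ≈⟨ *-congˡ (∑⟨⟩-insert α β m k _) ⟩
      y * ([ suc k ]⟨ α , β ⟩ * ∑⟨ m , suc k ⟩ (λ v → total m (x ∷ low , v))) ∎

  ∑-total : ∀ m {l} (low : Vec Bool l) k → ∣ low ∣ ≡ k →
            ∑⟨ m , k ⟩ (λ v → total m (low , v)) ≈ motzkin m k

  private
    -- An image on the left does not change the set on the right, so the two sums commute. By
    -- induction the inner sum depends only on the size of the new left half, and `∑-rank` applies.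
    left : ∀ m k {l} (low : Vec Bool l) x y α β j → (∀ i → lookup low i ≡ true → ∣ x ∷ low [ i ]≔ false ∣ ≡ j) →
      ∑⟨ m , j ⟩ (λ v → ∑[ i < l ]
        (if lookup low i then y * rank α β low i * total m (x ∷ low [ i ]≔ false , v) else 0#)) ≈
      y * ([ ∣ low ∣ ]⟨ α , β ⟩ * motzkin m j)
    left m k {l} low x y α β j size = begin
      _ ≈⟨ ∑⟨⟩-cong m j (λ v _ → factor y (lookup low) (rank α β low) (λ i → total m (x ∷ low [ i ]≔ false , v))) ⟩
      ∑⟨ m , j ⟩ (λ v → y * ∑[ i < l ] (if lookup low i then rank α β low i * total m (x ∷ low [ i ]≔ false , v) else 0#))
        ≈⟨ *-distribˡ-∑⟨⟩ m j y _ ⟩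
      y * ∑⟨ m , j ⟩ (λ v → ∑[ i < l ] (if lookup low i then rank α β low i * total m (x ∷ low [ i ]≔ false , v) else 0#))
        ≈⟨ *-congˡ (∑⟨⟩-comm m j l _) ⟩
      y * ∑[ i < l ] ∑⟨ m , j ⟩ (λ v → if lookup low i then rank α β low i * total m (x ∷ low [ i ]≔ false , v) else 0#)
        ≈⟨ *-congˡ (sum-cong-≋ {l} λ i → pull i (lookup low i)) ⟩
      y * ∑[ i < l ] (if lookup low i then rank α β low i * ∑⟨ m , j ⟩ (λ v → total m (x ∷ low [ i ]≔ false , v)) else 0#)
        ≈⟨ *-congˡ (∑-rank α β (motzkin m j) low _ λ i eq → ∑-total m (x ∷ low [ i ]≔ false) j (size i eq)) ⟩
      y * ([ ∣ low ∣ ]⟨ α , β ⟩ * motzkin m j) ∎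
      where
      pull : ∀ i z →
        ∑⟨ m , j ⟩ (λ v → if z then rank α β low i * total m (x ∷ low [ i ]≔ false , v) else 0#) ≈
        (if z then rank α β low i * ∑⟨ m , j ⟩ (λ v → total m (x ∷ low [ i ]≔ false , v)) else 0#)
      pull i true  = *-distribˡ-∑⟨⟩ m j _ _
      pull i false = ∑⟨⟩-zero m j

    free : ∀ m {l} (low : Vec Bool l) k → ∣ low ∣ ≡ k →
      ∑⟨ m , k ⟩ (λ v → total (suc m) (low , false ∷ v)) ≈
      t * ([ k ]⟨ f , g ⟩ * motzkin m k) + (u * w ^ k * motzkin m k + up k * motzkin m (suc k))
    free m low k ≡.refl = begin
      _ ≈⟨ ∑⟨⟩-distrib-+ m k _ _ ⟩
      _ ≈⟨ +-cong (left m k low true t f g k (λ i → ∣remove∣ low i)) (trans (∑⟨⟩-distrib-+ m k _ _) (+-cong fixed higher)) ⟩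
      _ ∎
      where
      fixed : ∑⟨ m , k ⟩ (λ v → u * w ^ ∣ v ∣ * total m (false ∷ low , v)) ≈ u * w ^ k * motzkin m k
      fixed = begin
        _ ≈⟨ ∑⟨⟩-cong m k (λ v eq → *-congʳ (*-congˡ (reflexive (≡.cong (w ^_) eq)))) ⟩
        ∑⟨ m , k ⟩ (λ v → u * w ^ k * total m (false ∷ low , v))
          ≈⟨ *-distribˡ-∑⟨⟩ m k (u * w ^ k) _ ⟩
        u * w ^ k * ∑⟨ m , k ⟩ (λ v → total m (false ∷ low , v))
          ≈⟨ *-congˡ (∑-total m (false ∷ low) k ≡.refl) ⟩
        u * w ^ k * motzkin m k ∎

      higher : _ ≈ up k * motzkin m (suc k)
      higher = trans (right m k low true p c d)
        (trans (*-congˡ (*-congˡ (∑-total m (true ∷ low) (suc k) ≡.refl))) (sym (*-assoc p _ _)))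

    -- The current vertex is one of the k + 1 used ones, so `v` has only k. An image on the right
    -- restores k + 1, whence `[ suc k ]` rather than the `[ suc (suc k) ]` of an up step at this
    -- height.
    taken : ∀ m {l} (low : Vec Bool l) k → ∣ low ∣ ≡ suc k →
      ∑⟨ m , k ⟩ (λ v → total (suc m) (low , true ∷ v)) ≈
      down (suc k) * motzkin m k + s * ([ suc k ]⟨ a , b ⟩ * motzkin m (suc k))
    taken m low k eq = begin
      _ ≈⟨ ∑⟨⟩-distrib-+ m k _ _ ⟩
      _ ≈⟨ +-cong
             (trans (left m k low false r h ℓ k (λ i eq′ → ℕ.suc-injective (≡.trans (∣remove∣ low i eq′) eq)))
                    (trans (*-congˡ (*-congʳ (reflexive (≡.cong ([_]⟨ h , ℓ ⟩) eq)))) (sym (*-assoc r _ _))))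
             (trans (∑⟨⟩-cong m k (λ v _ → +-identityˡ _))
                    (trans (right m k low false s a b) (*-congˡ (*-congˡ (∑-total m (false ∷ low) (suc k) eq))))) ⟩
      _ ∎

  ∑-total zero    low zero    eq = refl
  ∑-total zero    low (suc k) eq = refl
  ∑-total (suc m) low zero    eq = begin
    _ ≈⟨ free m low 0 eq ⟩
    t * (0# * motzkin m 0) + (u * 1# * motzkin m 0 + up 0 * motzkin m 1)
      ≈⟨ solve 5 (λ t x u y s → t :* (con 0 :* x) :+ (u :* con 1 :* x :+ y) :=
                                (u :* con 1 :+ s :* con 0 :+ t :* con 0) :* x :+ y) refl _ _ _ _ s ⟩
    level 0 * motzkin m 0 + up 0 * motzkin m 1 ∎
  ∑-total (suc m) low (suc k) eq = begin
    _ ≈⟨ +-cong (free m low (suc k) eq) (taken m low k eq) ⟩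
    _ ≈⟨ solve 9 (λ t fg x u w y z s ab → t :* (fg :* x) :+ (u :* w :* x :+ y) :+ (z :+ s :* (ab :* x)) :=
                                (u :* w :+ s :* ab :+ t :* fg) :* x :+ y :+ z) refl
           t [ suc k ]⟨ f , g ⟩ (motzkin m (suc k)) u (w ^ suc k) _ _ s [ suc k ]⟨ a , b ⟩ ⟩
    level (suc k) * motzkin m (suc k) + up (suc k) * motzkin m (suc (suc k)) + down (suc k) * motzkin m k ∎

-- Renaming the vertices after one of them is processed

shift : ∀ {l m} → Vertex l (suc m) → Vertex (suc l) m
shift (inj₁ i)       = inj₁ (suc i)
shift (inj₂ zero)    = inj₁ zero
shift (inj₂ (suc i)) = inj₂ i

shift-injective : ∀ {l m} (y z : Vertex l (suc m)) → shift y ≡ shift z → y ≡ z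
shift-injective (inj₁ i)       (inj₁ j)       ≡.refl = ≡.refl
shift-injective (inj₁ i)       (inj₂ zero)    ()
shift-injective (inj₁ i)       (inj₂ (suc j)) ()
shift-injective (inj₂ zero)    (inj₂ zero)    eq = ≡.refl
shift-injective (inj₂ (suc i)) (inj₂ (suc j)) ≡.refl = ≡.refl

available-choose-≡ : ∀ {l m} (S : State l (suc m)) z → available (choose S z) (shift z) ≡ false
available-choose-≡ (low , x ∷ high) (inj₁ i)       = Vec.lookup∘updateAt i low
available-choose-≡ (low , x ∷ high) (inj₂ zero)    = ≡.refl
available-choose-≡ (low , x ∷ high) (inj₂ (suc i)) = ≡.cong not (Vec.lookup∘updateAt i high)

available-choose-≢ : ∀ {l m} (S : State l (suc m)) y z → y ≢ z →
                     available (choose S z) (shift y) ≡ available S y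
available-choose-≢ (low , x ∷ high) (inj₁ i) (inj₁ j) y≢z =
  Vec.lookup∘updateAt′ i j (y≢z ∘ ≡.cong inj₁) low
available-choose-≢ (low , x ∷ high) (inj₂ (suc i)) (inj₂ (suc j)) y≢z =
  ≡.cong not (Vec.lookup∘updateAt′ i j (y≢z ∘ ≡.cong (inj₂ ∘ suc)) high)
available-choose-≢ (low , x ∷ high) (inj₂ zero)    (inj₂ zero)    y≢z = contradiction ≡.refl y≢z
available-choose-≢ (low , x ∷ high) (inj₁ i)       (inj₂ zero)    _ = ≡.refl
available-choose-≢ (low , x ∷ high) (inj₁ i)       (inj₂ (suc j)) _ = ≡.refl
available-choose-≢ (low , x ∷ high) (inj₂ zero)    (inj₁ j)       _ = ≡.refl
available-choose-≢ (low , x ∷ high) (inj₂ zero)    (inj₂ (suc j)) _ = ≡.refl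
available-choose-≢ (low , x ∷ high) (inj₂ (suc i)) (inj₁ j)       _ = ≡.refl
available-choose-≢ (low , x ∷ high) (inj₂ (suc i)) (inj₂ zero)    _ = ≡.refl

-- Iterated operations over lists

module ListFolds {c ℓ} (M : Monoid c ℓ) where

  open Monoid M
  open MonoidSum M using (sum)

  fold : ∀ {A : Set} → List A → (A → Carrier) → Carrier
  fold xs F = foldr _∙_ ε (List.map F xs)

  fold-map-++ : ∀ {A B : Set} (h : A → B) xs ys (F : B → Carrier) →
                fold (List.map h xs ++ ys) F ≈ fold xs (F ∘ h) ∙ fold ys F
  fold-map-++ h []       ys F = sym (identityˡ _)
  fold-map-++ h (x ∷ xs) ys F = trans (∙-congˡ (fold-map-++ h xs ys F)) (sym (assoc _ _ _))

  fold-tabulate : ∀ {A : Set} {n} (e : Fin n → A) (F : A → Carrier) → fold (tabulate e) F ≈ sum (F ∘ e)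
  fold-tabulate {n = zero}  e F = refl
  fold-tabulate {n = suc n} e F = ∙-congˡ (fold-tabulate (e ∘ suc) F)

  fold-cartesianProductWith : ∀ {A B C : Set} {n} (h : A → B → C) (e : Fin n → A) ys (F : C → Carrier) →
    fold (cartesianProductWith h (tabulate e) ys) F ≈ sum (λ i → fold ys (F ∘ h (e i)))
  fold-cartesianProductWith {n = zero}  h e ys F = refl
  fold-cartesianProductWith {n = suc n} h e ys F =
    trans (fold-map-++ (h (e zero)) ys _ F) (∙-congˡ (fold-cartesianProductWith h (e ∘ suc) ys F))

module ListSums {κ κ′} (R : CommutativeRing κ κ′) where

  open CommutativeRing R hiding (zero)
  open PowerSeries R

  ∑∈-cong : ∀ {A : Set} (xs : List A) {F G : A → Carrier} → (∀ x → F x ≈ G x) →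
            ∑∈-syntax xs F ≈ ∑∈-syntax xs G
  ∑∈-cong []       F≈G = refl
  ∑∈-cong (x ∷ xs) F≈G = +-cong (F≈G x) (∑∈-cong xs F≈G)

  *-distribˡ-∑∈ : ∀ {A : Set} (xs : List A) x (F : A → Carrier) →
                  ∑∈-syntax xs (λ y → x * F y) ≈ x * ∑∈-syntax xs F
  *-distribˡ-∑∈ []       x F = sym (zeroʳ x)
  *-distribˡ-∑∈ (y ∷ xs) x F = trans (+-congˡ (*-distribˡ-∑∈ xs x F)) (sym (distribˡ x _ _))

-- The sum over permutations as a sum over choices of images

module PermutationSums {κ κ′} (R : CommutativeRing κ κ′)
  (a b c d f g h ℓ p r s t u w : CommutativeRing.Carrier R) where

  open CommutativeRing R hiding (zero)
  open PowerSeries R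
  open SeriesProperties R
  open Selections R
  open ListFolds +-monoid using (fold-cartesianProductWith)
  open ListSums R
  open Histories R a b c d f g h ℓ p r s t u w
  open RingProperties ring using (+-cancelˡ)
  open SemiringSum semiring using (sum-cong-≋; sum-remove)
  open SetoidReasoning setoid
  open SemiringSolver commutativeSemiring using (solve; _:+_; _:*_; _:=_)

  wordWeight : ∀ m {l} → State l m → (Fin m → Vertex l m) → Carrier
  wordWeight zero    S σ = 1#
  wordWeight (suc m) S σ = weight S (σ zero) * wordWeight m (choose S (σ zero)) (shift ∘ σ ∘ suc)

  wordWeight-cong : ∀ m {l} (S : State l m) {σ τ : Fin m → Vertex l m} → σ ≗ τ →
                    wordWeight m S σ ≡ wordWeight m S τ
  wordWeight-cong zero    S σ≗τ = ≡.refl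
  wordWeight-cong (suc m) S {σ} {τ} σ≗τ rewrite σ≗τ zero =
    ≡.cong (weight S (τ zero) *_) (wordWeight-cong m _ (≡.cong shift ∘ σ≗τ ∘ suc))

  -- That every available vertex occurs is expressed by the exchange of sums `reindex`: this is how
  -- it is used, and it passes to the next state by cancelling one term.
  record Enumerates {l m} (S : State l m) (e : Fin m → Vertex l m) : Set (κ ⊔ κ′) where
    field
      isAvailable : ∀ i → available S (e i) ≡ true
      injective   : ∀ i j → e i ≡ e j → i ≡ j
      reindex     : ∀ (F : Vertex l m → Carrier) → ∑ᵥ (λ z → if available S z then F z else 0#) ≈ ∑[ i < m ] F (e i)

  private
    sum-without : ∀ {n} (A B : Fin n → Bool) i (F : Fin n → Carrier) →
      A i ≡ true → B i ≡ false → (∀ j → j ≢ i → B j ≡ A j) →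
      ∑[ j < n ] (if A j then F j else 0#) ≈ F i + ∑[ j < n ] (if B j then F j else 0#)
    sum-without {suc n} A B i F Ai Bi B≗A = begin
      ∑[ j < suc n ] (if A j then F j else 0#)
        ≈⟨ sum-remove {i = i} (λ j → if A j then F j else 0#) ⟩
      (if A i then F i else 0#) + rest A
        ≡⟨ ≡.cong (λ x → (if x then F i else 0#) + rest A) Ai ⟩
      F i + rest A
        ≈⟨ +-congˡ (sum-cong-≋ {n} λ j → reflexive
             (≡.cong (λ x → if x then F (punchIn i j) else 0#) (≡.sym (B≗A (punchIn i j) (Fin.punchInᵢ≢i i j))))) ⟩
      F i + rest B
        ≈⟨ +-congˡ (+-identityˡ _) ⟨
      F i + (0# + rest B)
        ≡⟨ ≡.cong (λ x → F i + ((if x then F i else 0#) + rest B)) Bi ⟨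
      F i + ((if B i then F i else 0#) + rest B)
        ≈⟨ +-congˡ (sum-remove {i = i} (λ j → if B j then F j else 0#)) ⟨
      F i + ∑[ j < suc n ] (if B j then F j else 0#) ∎
      where
      rest : (Fin (suc n) → Bool) → Carrier
      rest A = ∑[ j < n ] (if A (punchIn i j) then F (punchIn i j) else 0#)

    ∑ᵥ-without : ∀ {l m} (A B : Vertex l m → Bool) z (F : Vertex l m → Carrier) →
      A z ≡ true → B z ≡ false → (∀ y → y ≢ z → B y ≡ A y) →
      ∑ᵥ (λ y → if A y then F y else 0#) ≈ F z + ∑ᵥ (λ y → if B y then F y else 0#)
    ∑ᵥ-without {l} {m} A B (inj₁ i) F Az Bz B≗A = trans
      (+-cong (sum-without (A ∘ inj₁) (B ∘ inj₁) i (F ∘ inj₁) Az Bz (λ j j≢i → B≗A (inj₁ j) (j≢i ∘ Sum.inj₁-injective)))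
        (sum-cong-≋ {m} λ j → reflexive
          (≡.cong (λ x → if x then F (inj₂ j) else 0#) (≡.sym (B≗A (inj₂ j) λ ())))))
      (+-assoc _ _ _)
    ∑ᵥ-without {l} {m} A B (inj₂ i) F Az Bz B≗A = trans
      (+-cong
        (sum-cong-≋ {l} λ j → reflexive
          (≡.cong (λ x → if x then F (inj₁ j) else 0#) (≡.sym (B≗A (inj₁ j) λ ()))))
        (sum-without (A ∘ inj₂) (B ∘ inj₂) i (F ∘ inj₂) Az Bz (λ j j≢i → B≗A (inj₂ j) (j≢i ∘ Sum.inj₂-injective))))
      (solve 3 (λ x y z → x :+ (y :+ z) := y :+ (x :+ z)) refl _ _ _)

    ∑ᵥ-shift : ∀ {l m} (F : Vertex (suc l) m → Carrier) → ∑ᵥ F ≈ ∑ᵥ (F ∘ shift {l})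
    ∑ᵥ-shift F = solve 3 (λ x y z → (x :+ y) :+ z := y :+ (x :+ z)) refl _ _ _

  choose-enumerates : ∀ {l m} (S : State l (suc m)) e j → Enumerates S e →
                      Enumerates (choose S (e j)) (shift ∘ e ∘ punchIn j)
  choose-enumerates {l} {m} S e j E = record
    { isAvailable = λ i → ≡.trans (available-choose-≢ S (e (punchIn j i)) (e j) (Fin.punchInᵢ≢i j i ∘ injective _ _))
                                  (isAvailable (punchIn j i))
    ; injective   = λ i k eq → Fin.punchIn-injective j i k (injective _ _ (shift-injective _ _ eq))
    ; reindex     = λ F → +-cancelˡ (F (shift (e j))) _ _ (begin
        F (shift (e j)) + ∑ᵥ (λ z → if available (choose S (e j)) z then F z else 0#)
          ≈⟨ +-congˡ (∑ᵥ-shift λ z → if available (choose S (e j)) z then F z else 0#) ⟩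
        F (shift (e j)) + ∑ᵥ (λ z → if available (choose S (e j)) (shift z) then F (shift z) else 0#)
          ≈⟨ ∑ᵥ-without (available S) (available (choose S (e j)) ∘ shift) (e j) (F ∘ shift)
               (isAvailable j) (available-choose-≡ S (e j)) (λ y → available-choose-≢ S y (e j)) ⟨
        ∑ᵥ (λ z → if available S z then F (shift z) else 0#)
          ≈⟨ reindex (F ∘ shift) ⟩
        ∑[ i < suc m ] F (shift (e i))
          ≈⟨ sum-remove {i = j} (F ∘ shift ∘ e) ⟩
        F (shift (e j)) + ∑[ i < m ] F (shift (e (punchIn j i))) ∎)
    }
    where open Enumerates E

  -- `permutations` inserts an image j of the first vertex into a permutation of the rest, just as
  -- `total` sums over the first choice; `e ∘ punchIn j` lists the remaining images.
  ∑-wordWeight : ∀ m {l} (S : State l m) e → Enumerates S e →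
                 ∑[ π ∈ permutations m ] wordWeight m S (e ∘ (π ⟨$⟩ʳ_)) ≈ total m S
  ∑-wordWeight zero    S e E = +-identityʳ 1#
  ∑-wordWeight (suc m) S e E = begin
    ∑[ π ∈ permutations (suc m) ] wordWeight (suc m) S (e ∘ (π ⟨$⟩ʳ_))
      ≈⟨ fold-cartesianProductWith (insert zero) id (permutations m) (λ π → wordWeight (suc m) S (e ∘ (π ⟨$⟩ʳ_))) ⟩
    ∑[ j < suc m ] ∑[ π ∈ permutations m ] wordWeight (suc m) S (e ∘ (insert zero j π ⟨$⟩ʳ_))
      ≈⟨ sum-cong-≋ {suc m} (λ j → trans (trans
           (∑∈-cong (permutations m) (λ π → *-congˡ (reflexive
             (wordWeight-cong m _ λ i → ≡.cong (shift ∘ e) (insert-punchIn zero j π i)))))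
           (*-distribˡ-∑∈ (permutations m) (weight S (e j)) _))
           (*-congˡ (∑-wordWeight m (choose S (e j)) (shift ∘ e ∘ punchIn j) (choose-enumerates S e j E)))) ⟩
    ∑[ j < suc m ] (weight S (e j) * total m (choose S (e j)))
      ≈⟨ Enumerates.reindex E (λ z → weight S z * total m (choose S z)) ⟨
    total (suc m) S ∎

  initial : ∀ n → State 0 n
  initial n = [] , replicate n false

  initial-enumerates : ∀ n → Enumerates (initial n) inj₂
  initial-enumerates n = record
    { isAvailable = λ i → ≡.cong not (Vec.lookup-replicate i false)
    ; injective   = λ i j → Sum.inj₂-injective
    ; reindex     = λ F → trans (+-identityˡ _) (sum-cong-≋ {n} λ i → reflexive
        (≡.cong (λ x → if not x then F (inj₂ i) else 0#) (Vec.lookup-replicate i false)))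
    }

  ∑⟨⟩-empty : ∀ n G → ∑⟨ n , 0 ⟩ G ≡ G (replicate n false)
  ∑⟨⟩-empty zero    G = ≡.refl
  ∑⟨⟩-empty (suc n) G = ∑⟨⟩-empty n (G ∘ (false ∷_))

  open MotzkinPaths level up down

  ∑-wordWeight≈jFraction : ∀ n →
    ∑[ σ ∈ permutations n ] wordWeight n (initial n) (inj₂ ∘ (σ ⟨$⟩ʳ_)) ≈
    jFraction level (λ n → p * r * [ n ]⟨ c , d ⟩ * [ n ]⟨ h , ℓ ⟩) n
  ∑-wordWeight≈jFraction n = begin
    ∑[ σ ∈ permutations n ] wordWeight n (initial n) (inj₂ ∘ (σ ⟨$⟩ʳ_))
      ≈⟨ ∑-wordWeight n (initial n) inj₂ (initial-enumerates n) ⟩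
    total n (initial n)
      ≡⟨ ∑⟨⟩-empty n (λ v → total n ([] , v)) ⟨
    ∑⟨ n , 0 ⟩ (λ v → total n ([] , v))
      ≈⟨ ∑-total n [] 0 ≡.refl ⟩
    motzkin n 0
      ≈⟨ motzkin≈jFraction β (λ k → interchange [ suc k ]⟨ c , d ⟩ [ suc k ]⟨ h , ℓ ⟩) n ⟩
    jFraction level β n ∎
    where
    β : ℕ → Carrier
    β n = p * r * [ n ]⟨ c , d ⟩ * [ n ]⟨ h , ℓ ⟩

    interchange : ∀ x y → p * r * x * y ≈ p * x * (r * y)
    interchange x y = solve 4 (λ p r x y → p :* r :* x :* y := p :* x :* (r :* y)) refl p r x y

-- Powers with counted exponents as products

module Products {κ κ′} (R : CommutativeRing κ κ′) where

  open CommutativeRing R hiding (zero)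
  open PowerSeries R
  open Selections R using (rank)
  open SetoidReasoning setoid
  open ListFolds *-monoid using (fold-tabulate; fold-cartesianProductWith) renaming (fold to ∏∈)
  open CommutativeMonoidSum *-commutativeMonoid public using () renaming
    ( sum to product; sum-cong-≋ to ∏-cong; ∑-comm to ∏-comm
    ; ∑-distrib-+ to ∏-distrib-*; ∑-permute to ∏-permute; sum-replicate-zero to ∏-one)

  infixl 10 ∏-syntax

  ∏-syntax : ∀ n → (Fin n → Carrier) → Carrier
  ∏-syntax _ = product

  syntax ∏-syntax n (λ i → x) = ∏[ i < n ] x

  ∏-≈1 : ∀ n {F : Fin n → Carrier} → (∀ i → F i ≈ 1#) → ∏[ i < n ] F i ≈ 1#
  ∏-≈1 n F≈1 = trans (∏-cong {n} F≈1) (∏-one n)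

  private
    ∏∈-allFin² : ∀ {n} (F : Fin n × Fin n → Carrier) →
      ∏∈ (cartesianProduct (allFin n) (allFin n)) F ≈ ∏[ i < n ] ∏[ j < n ] F (i , j)
    ∏∈-allFin² {n} F = trans
      (fold-cartesianProductWith _,_ id (allFin n) F)
      (∏-cong {n} λ i → fold-tabulate id (F ∘ (i ,_)))

    ^-length-filter : ∀ {A : Set} {P : A → Set} (P? : Decidable P) x xs →
      x ^ length (filter P? xs) ≈ ∏∈ xs (λ y → if does (P? y) then x else 1#)
    ^-length-filter P? x []       = refl
    ^-length-filter P? x (y ∷ xs) with does (P? y)
    ... | true  = *-congˡ (^-length-filter P? x xs)
    ... | false = trans (^-length-filter P? x xs) (sym (*-identityˡ _))

    module _ {A : Set} {P Q PQ : A → Set} (P? : Decidable P) (Q? : Decidable Q) (PQ? : Decidable PQ)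
             (does-PQ : ∀ y → does (PQ? y) ≡ does (P? y) ∧ does (Q? y)) where

      length-filter-≤ : ∀ xs → length (filter PQ? xs) ℕ.≤ length (filter P? xs)
      length-filter-≤ []       = ℕ.z≤n
      length-filter-≤ (y ∷ xs) with does (PQ? y) | does (P? y) | does (Q? y) | does-PQ y
      ... | _ | true  | true  | ≡.refl = ℕ.s≤s (length-filter-≤ xs)
      ... | _ | true  | false | ≡.refl = ℕ.m≤n⇒m≤1+n (length-filter-≤ xs)
      ... | _ | false | _     | ≡.refl = length-filter-≤ xs

      ^-length-filter-∸ : ∀ x y xs →
        x ^ length (filter PQ? xs) * y ^ (length (filter P? xs) ∸ length (filter PQ? xs)) ≈
        ∏∈ xs (λ z → if does (P? z) then (if does (Q? z) then x else y) else 1#)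
      ^-length-filter-∸ x y []       = *-identityˡ 1#
      ^-length-filter-∸ x y (z ∷ xs) with does (PQ? z) | does (P? z) | does (Q? z) | does-PQ z
      ... | _ | true  | true  | ≡.refl = trans (*-assoc _ _ _) (*-congˡ (^-length-filter-∸ x y xs))
      ... | _ | false | _     | ≡.refl = trans (^-length-filter-∸ x y xs) (sym (*-identityˡ _))
      ... | _ | true  | false | ≡.refl = begin
        -- Truncated subtraction commutes with the successor only because `M` is at most `N`.
        x ^ M * y ^ (suc N ∸ M)    ≡⟨ ≡.cong (λ k → x ^ M * y ^ k) (ℕ.+-∸-assoc 1 (length-filter-≤ xs)) ⟩
        x ^ M * (y * y ^ (N ∸ M))  ≈⟨ *-assoc _ _ _ ⟨
        x ^ M * y * y ^ (N ∸ M)    ≈⟨ *-congʳ (*-comm _ _) ⟩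
        y * x ^ M * y ^ (N ∸ M)    ≈⟨ *-assoc _ _ _ ⟩
        y * (x ^ M * y ^ (N ∸ M))  ≈⟨ *-congˡ (^-length-filter-∸ x y xs) ⟩
        _                          ∎
        where
        N M : ℕ
        N = length (filter P? xs)
        M = length (filter PQ? xs)

  ^-count : ∀ {n} {P : Fin n → Set} (P? : Decidable P) x →
            x ^ count P? ≈ ∏[ i < n ] (if does (P? i) then x else 1#)
  ^-count {n} P? x = trans (^-length-filter P? x (allFin n)) (fold-tabulate {n = n} id λ i → if does (P? i) then x else 1#)

  ^-count₂ : ∀ {n} {P : Fin n → Fin n → Set} (P? : ∀ i j → Dec (P i j)) x →
             x ^ count₂ P? ≈ ∏[ i < n ] ∏[ j < n ] (if does (P? i j) then x else 1#)
  ^-count₂ {n} P? x =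
    trans (^-length-filter (uncurry P?) x (cartesianProduct (allFin n) (allFin n)))
      (∏∈-allFin² {n} (λ z → if does (uncurry P? z) then x else 1#))

  ^-count-∸ : ∀ {n} {P Q PQ : Fin n → Set} (P? : Decidable P) (Q? : Decidable Q) (PQ? : Decidable PQ) →
    (∀ i → does (PQ? i) ≡ does (P? i) ∧ does (Q? i)) → ∀ x y →
    x ^ count PQ? * y ^ (count P? ∸ count PQ?) ≈
    ∏[ i < n ] (if does (P? i) then (if does (Q? i) then x else y) else 1#)
  ^-count-∸ {n} P? Q? PQ? does-PQ x y =
    trans (^-length-filter-∸ P? Q? PQ? does-PQ x y (allFin n))
      (fold-tabulate {n = n} id λ i → if does (P? i) then (if does (Q? i) then x else y) else 1#)

  ^-count₂-∸ : ∀ {n} {P Q PQ : Fin n → Fin n → Set}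
    (P? : ∀ i j → Dec (P i j)) (Q? : ∀ i j → Dec (Q i j)) (PQ? : ∀ i j → Dec (PQ i j)) →
    (∀ i j → does (PQ? i j) ≡ does (P? i j) ∧ does (Q? i j)) → ∀ x y →
    x ^ count₂ PQ? * y ^ (count₂ P? ∸ count₂ PQ?) ≈
    ∏[ i < n ] ∏[ j < n ] (if does (P? i j) then (if does (Q? i j) then x else y) else 1#)
  ^-count₂-∸ {n} P? Q? PQ? does-PQ x y = trans
    (^-length-filter-∸ (uncurry P?) (uncurry Q?) (uncurry PQ?) (uncurry does-PQ) x y (cartesianProduct (allFin n) (allFin n)))
    (∏∈-allFin² {n} λ z → if does (uncurry P? z) then (if does (uncurry Q? z) then x else y) else 1#)

  ∏-power : ∀ x {n} (v : Vec Bool n) (F : Fin n → Carrier) →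
            (∀ i → F i ≈ (if lookup v i then x else 1#)) → ∏[ i < n ] F i ≈ x ^ ∣ v ∣
  ∏-power x []          F F≈ = refl
  ∏-power x (true  ∷ v) F F≈ = *-cong (F≈ zero) (∏-power x v (F ∘ suc) (F≈ ∘ suc))
  ∏-power x (false ∷ v) F F≈ =
    trans (*-cong (F≈ zero) (∏-power x v (F ∘ suc) (F≈ ∘ suc))) (*-identityˡ _)

  -- Turns the product of the pair factors over one half into the rank in `weight`. The factor at
  -- `i` is 1 because the image of the current vertex forms no pair with itself.
  ∏-rank : ∀ α β {n} (v : Vec Bool n) i (F : Fin n → Carrier) →
           (∀ j → j Fin.< i → F j ≈ (if lookup v j then β else 1#)) →
           F i ≈ 1# →
           (∀ j → i Fin.< j → F j ≈ (if lookup v j then α else 1#)) →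
           ∏[ j < n ] F j ≈ rank α β v i
  ∏-rank α β (_ ∷ v) zero    F F< F≈1 F> =
    trans (*-cong F≈1 (∏-power α v (F ∘ suc) λ j → F> (suc j) (ℕ.s≤s ℕ.z≤n))) (*-identityˡ _)
  ∏-rank α β (x ∷ v) (suc i) F F< F≈1 F> =
    *-cong (F< zero (ℕ.s≤s ℕ.z≤n))
           (∏-rank α β v i (F ∘ suc) (λ j → F< (suc j) ∘ ℕ.s≤s) F≈1 (λ j → F> (suc j) ∘ ℕ.s≤s))

-- Distributing the statistics over single vertices

module Monomials {κ κ′} (R : CommutativeRing κ κ′)
  (a b c d f g h ℓ p r s t u w : CommutativeRing.Carrier R) {n} (σ : Permutation′ n) where

  open CommutativeRing R hiding (zero)
  open PowerSeries R
  open Products R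
  open SetoidReasoning setoid

  to from : Fin n → Fin n
  to   i = σ ⟨$⟩ʳ i
  from i = σ ⟨$⟩ˡ i

  infix 7 _<?_ _≟_

  _<?_ _≟_ : Fin n → Fin n → Bool
  i <? j = toℕ i <ᵇ toℕ j
  i ≟ j  = does (i Fin.≟ j)

  gate : Bool → Bool → Bool → Carrier → Carrier
  gate x y z A = if x ∧ (y ∧ z) then A else 1#

  -- The pairs counted by the statistics are grouped by the vertex k whose position
  -- in its cycle decides between linked and unlinked.  The other vertex of the pair
  -- is represented by its image y.

  single : Fin n → Carrier
  single k =
    (if k <? to k then (if from k <? k then s else p) else 1#) *
    (if to k <? k then (if k <? from k then t else r) else 1#) *
    (if k ≟ to k then u else 1#)

  -- With an arc drawn from each vertex to its image, the first factor of `upper` and of `lower`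
  -- detects arcs that enclose the arc of `k`, the second one arcs that cross it.
  upper lower fixed : Fin n → Fin n → Carrier
  upper k y =
    gate (from y <? k) (k <? to k) (to k <? y) (if from k <? k then a else c) *
    gate (from y <? k) (k <? y) (y <? to k) (if from k <? k then b else d)
  lower k y =
    gate (y <? to k) (to k <? k) (k <? from y) (if k <? from k then f else h) *
    gate (to k <? y) (y <? k) (k <? from y) (if k <? from k then g else ℓ)
  fixed k y = gate (from y <? k) (k ≟ to k) (to k <? y) w

  local : Fin n → Carrier
  local k = single k * ∏[ y < n ] upper k y * ∏[ y < n ] lower k y * ∏[ y < n ] fixed k y

  monomial : Carrier
  monomial =
    a ^ ile σ * b ^ nile σ * c ^ (ie σ ∸ ile σ) * d ^ (nie σ ∸ nile σ)
    * f ^ ilae σ * g ^ nilae σ * h ^ (iae σ ∸ ilae σ) * ℓ ^ (niae σ ∸ nilae σ)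
    * p ^ (exc σ ∸ le σ) * r ^ (aexc σ ∸ lae σ) * s ^ le σ * t ^ lae σ
    * u ^ fp σ * w ^ iefp σ

  private
    by-image : ∀ (F : Fin n → Fin n → Carrier) → ∏[ i < n ] F i (to i) ≈ ∏[ y < n ] F (from y) y
    by-image F = trans (∏-permute (λ i → F i (to i)) (Perm.flip σ))
      (∏-cong {n} λ y → reflexive (≡.cong (F (from y)) (Perm.inverseʳ σ)))

    -- The deciding vertex is the second of the pair for excedances and fixed points, but the first
    -- for anti-excedances; hence the two versions.
    ∏-by-image₁ : ∀ (F : Fin n → Fin n → Fin n → Carrier) →
      ∏[ i < n ] ∏[ j < n ] F j i (to i) ≈ ∏[ k < n ] ∏[ y < n ] F k (from y) y
    ∏-by-image₁ F = trans (∏-comm {n} {n} (λ i j → F j i (to i))) (∏-cong {n} λ k → by-image (F k))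

    ∏-by-image₂ : ∀ (F : Fin n → Fin n → Fin n → Carrier) →
      ∏[ i < n ] ∏[ j < n ] F i j (to j) ≈ ∏[ k < n ] ∏[ y < n ] F k (from y) y
    ∏-by-image₂ F = ∏-cong {n} λ k → by-image (F k)

    ∏²-distrib-* : ∀ (F G : Fin n → Fin n → Carrier) →
      ∏[ k < n ] ∏[ y < n ] (F k y * G k y) ≈ ∏[ k < n ] ∏[ y < n ] F k y * ∏[ k < n ] ∏[ y < n ] G k y
    ∏²-distrib-* F G = trans (∏-cong {n} λ k → ∏-distrib-* (F k) (G k)) (∏-distrib-* {n} _ _)

    uppers : (a ^ ile σ * c ^ (ie σ ∸ ile σ)) * (b ^ nile σ * d ^ (nie σ ∸ nile σ)) ≈
             ∏[ k < n ] ∏[ y < n ] upper k y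
    uppers = trans
      (*-cong (trans (^-count₂-∸ {n} _ (λ i j → from j Fin.<? j) _ (λ _ _ → ≡.refl) a c)
                (∏-by-image₁ λ k i y → gate (i <? k) (k <? to k) (to k <? y) (if from k <? k then a else c)))
              (trans (^-count₂-∸ {n} _ (λ i j → from j Fin.<? j) _ (λ _ _ → ≡.refl) b d)
                (∏-by-image₁ λ k i y → gate (i <? k) (k <? y) (y <? to k) (if from k <? k then b else d))))
      (sym (∏²-distrib-* _ _))

    lowers : (f ^ ilae σ * h ^ (iae σ ∸ ilae σ)) * (g ^ nilae σ * ℓ ^ (niae σ ∸ nilae σ)) ≈
             ∏[ k < n ] ∏[ y < n ] lower k y
    lowers = trans
      (*-cong (trans (^-count₂-∸ {n} _ (λ i j → i Fin.<? from i) _ (λ _ _ → ≡.refl) f h)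
                (∏-by-image₂ λ k j y → gate (y <? to k) (to k <? k) (k <? j) (if k <? from k then f else h)))
              (trans (^-count₂-∸ {n} _ (λ i j → i Fin.<? from i) _ (λ _ _ → ≡.refl) g ℓ)
                (∏-by-image₂ λ k j y → gate (to k <? y) (y <? k) (k <? j) (if k <? from k then g else ℓ))))
      (sym (∏²-distrib-* _ _))

    fixeds : w ^ iefp σ ≈ ∏[ k < n ] ∏[ y < n ] fixed k y
    fixeds = trans (^-count₂ {n} _ w) (∏-by-image₁ λ k i y → gate (i <? k) (k ≟ to k) (to k <? y) w)

    singles : (s ^ le σ * p ^ (exc σ ∸ le σ)) * (t ^ lae σ * r ^ (aexc σ ∸ lae σ)) * u ^ fp σ ≈
              ∏[ k < n ] single k
    singles = begin
      -- `le` lists the linking condition first, contrary to the other linked statistics.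
      _ ≈⟨ *-cong (*-cong (^-count-∸ {n} _ (λ i → from i Fin.<? i) _ (λ i → Bool.∧-comm (from i <? i) (i <? to i)) s p)
                          (^-count-∸ {n} _ (λ i → i Fin.<? from i) _ (λ _ → ≡.refl) t r))
                  (^-count {n} _ u) ⟩
      _ ≈⟨ *-congʳ (∏-distrib-* {n} _ _) ⟨
      _ ≈⟨ ∏-distrib-* {n} _ _ ⟨
      _ ∎

  monomial≈∏-local : monomial ≈ ∏[ k < n ] local k
  monomial≈∏-local = begin
    monomial
      ≈⟨ solve 14 (λ a b c d f g h ℓ p r s t u w →
           (((((((((((((a ⊕ b) ⊕ c) ⊕ d) ⊕ f) ⊕ g) ⊕ h) ⊕ ℓ) ⊕ p) ⊕ r) ⊕ s) ⊕ t) ⊕ u) ⊕ w) ⊜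
           (((((s ⊕ p) ⊕ (t ⊕ r)) ⊕ u) ⊕ ((a ⊕ c) ⊕ (b ⊕ d))) ⊕ ((f ⊕ h) ⊕ (g ⊕ ℓ))) ⊕ w)
           refl _ _ _ _ _ _ _ _ _ _ _ _ _ _ ⟩
    _ ≈⟨ *-cong (*-cong (*-cong singles uppers) lowers) fixeds ⟩
    _ ≈⟨ *-congʳ (*-congʳ (∏-distrib-* {n} _ _)) ⟨
    _ ≈⟨ *-congʳ (∏-distrib-* {n} _ _) ⟨
    _ ≈⟨ ∏-distrib-* {n} _ _ ⟨
    ∏[ k < n ] local k ∎
    where
    open MonoidSolver *-commutativeMonoid using (solve; _⊕_; _⊜_)

-- Boolean comparison of natural numbers

<⇒<ᵇ≡true : ∀ {m n} → m ℕ.< n → (m <ᵇ n) ≡ true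
<⇒<ᵇ≡true {zero}  (ℕ.s≤s _)   = ≡.refl
<⇒<ᵇ≡true {suc m} (ℕ.s≤s m<n) = <⇒<ᵇ≡true m<n

≤⇒<ᵇ≡false : ∀ {m n} → n ℕ.≤ m → (m <ᵇ n) ≡ false
≤⇒<ᵇ≡false ℕ.z≤n       = ≡.refl
≤⇒<ᵇ≡false (ℕ.s≤s n≤m) = ≤⇒<ᵇ≡false n≤m

<ᵇ-flip : ∀ m n → m ≢ n → (n <ᵇ m) ≡ not (m <ᵇ n)
<ᵇ-flip zero    zero    m≢n = contradiction ≡.refl m≢n
<ᵇ-flip zero    (suc n) m≢n = ≡.refl
<ᵇ-flip (suc m) zero    m≢n = ≡.refl
<ᵇ-flip (suc m) (suc n) m≢n = <ᵇ-flip m n (m≢n ∘ ≡.cong suc)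

<ᵇ-suc-≡ : ∀ n → (n <ᵇ suc n) ≡ true
<ᵇ-suc-≡ n = <⇒<ᵇ≡true (ℕ.n<1+n n)

<ᵇ-suc-≢ : ∀ m n → m ≢ n → (m <ᵇ suc n) ≡ (m <ᵇ n)
<ᵇ-suc-≢ zero    zero    m≢n = contradiction ≡.refl m≢n
<ᵇ-suc-≢ zero    (suc n) m≢n = ≡.refl
<ᵇ-suc-≢ (suc m) zero    m≢n = ≡.refl
<ᵇ-suc-≢ (suc m) (suc n) m≢n = <ᵇ-suc-≢ m n (m≢n ∘ ≡.cong suc)

unshift : ∀ {l m} → Vertex (suc l) m → Vertex l (suc m)
unshift (inj₁ zero)    = inj₂ zero
unshift (inj₁ (suc i)) = inj₁ i
unshift (inj₂ i)       = inj₂ (suc i)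

unshift-shift : ∀ {l m} (z : Vertex l (suc m)) → unshift (shift z) ≡ z
unshift-shift (inj₁ i)       = ≡.refl
unshift-shift (inj₂ zero)    = ≡.refl
unshift-shift (inj₂ (suc i)) = ≡.refl

shift-unshift : ∀ {l m} (z : Vertex (suc l) m) → shift (unshift z) ≡ z
shift-unshift (inj₁ zero)    = ≡.refl
shift-unshift (inj₁ (suc i)) = ≡.refl
shift-unshift (inj₂ i)       = ≡.refl

-- The local factors are the weights of the choices

module MonomialWeights {κ κ′} (R : CommutativeRing κ κ′)
  (a b c d f g h ℓ p r s t u w : CommutativeRing.Carrier R) {n} (σ : Permutation′ n) where

  open CommutativeRing R hiding (zero)
  open PowerSeries R
  open Selections R using (rank)
  open Products R
  open Histories R a b c d f g h ℓ p r s t u w using (weight)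
  open PermutationSums R a b c d f g h ℓ p r s t u w using (wordWeight; initial)
  open Monomials R a b c d f g h ℓ p r s t u w σ
  open SetoidReasoning setoid

  private
    gate₁ : ∀ {x y A} → x ≡ false → (if x ∧ y then A else 1#) ≈ 1#
    gate₁ ≡.refl = refl

    gate₂ : ∀ {x y z A} → y ≡ false → gate x y z A ≈ 1#
    gate₂ {true}  ≡.refl = refl
    gate₂ {false} ≡.refl = refl

    gate₃ : ∀ {x y z A} → z ≡ false → gate x y z A ≈ 1#
    gate₃ {true}  {true}  ≡.refl = refl
    gate₃ {true}  {false} ≡.refl = refl
    gate₃ {false}         ≡.refl = refl

    gate-on₁ : ∀ {x x′ y z A} → x ≡ x′ → y ≡ true → z ≡ true → gate x y z A ≈ (if x′ then A else 1#)
    gate-on₁ {true}  ≡.refl ≡.refl ≡.refl = refl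
    gate-on₁ {false} ≡.refl ≡.refl ≡.refl = refl

    gate-on₃ : ∀ {x y z z′ A} → x ≡ true → y ≡ true → z ≡ z′ → gate x y z A ≈ (if z′ then A else 1#)
    gate-on₃ ≡.refl ≡.refl ≡.refl = refl

    gate-between₂₃ : ∀ {x A} i j k → k ℕ.≤ i → gate x (i <ᵇ j) (j <ᵇ k) A ≈ 1#
    gate-between₂₃ {x} i j k k≤i with ℕ.<-≤-connex j k
    ... | inj₁ j<k = gate₂ {x} (≤⇒<ᵇ≡false (ℕ.≤-trans (ℕ.<⇒≤ j<k) k≤i))
    ... | inj₂ k≤j = gate₃ {x} {i <ᵇ j} (≤⇒<ᵇ≡false k≤j)

    gate-between₁₂ : ∀ {z A} i j k → k ℕ.≤ i → gate (i <ᵇ j) (j <ᵇ k) z A ≈ 1#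
    gate-between₁₂ i j k k≤i with ℕ.<-≤-connex j k
    ... | inj₁ j<k = gate₁ (≤⇒<ᵇ≡false (ℕ.≤-trans (ℕ.<⇒≤ j<k) k≤i))
    ... | inj₂ k≤j = gate₂ {i <ᵇ j} (≤⇒<ᵇ≡false k≤j)

    1*1 : ∀ {x y} → x ≈ 1# → y ≈ 1# → x * y ≈ 1#
    1*1 x≈1 y≈1 = trans (*-cong x≈1 y≈1) (*-identityˡ 1#)

    1*x : ∀ {x y z} → x ≈ 1# → y ≈ z → x * y ≈ z
    1*x x≈1 y≈z = trans (*-cong x≈1 y≈z) (*-identityˡ _)

    x*1 : ∀ {x y z} → x ≈ z → y ≈ 1# → x * y ≈ z
    x*1 x≈z y≈1 = trans (*-cong x≈z y≈1) (*-identityʳ _)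

  upper-1 : ∀ k → toℕ (to k) ℕ.≤ toℕ k → ∀ y → upper k y ≈ 1#
  upper-1 k to≤k y = 1*1
    (gate₂ {from y <? k} (≤⇒<ᵇ≡false to≤k))
    (gate-between₂₃ {from y <? k} (toℕ k) (toℕ y) (toℕ (to k)) to≤k)

  lower-1 : ∀ k → toℕ k ℕ.≤ toℕ (to k) → ∀ y → lower k y ≈ 1#
  lower-1 k k≤to y = 1*1
    (gate₂ {y <? to k} (≤⇒<ᵇ≡false k≤to))
    (gate-between₁₂ {k <? from y} (toℕ (to k)) (toℕ y) (toℕ k) k≤to)

  fixed-1 : ∀ k → k ≢ to k → ∀ y → fixed k y ≈ 1#
  fixed-1 k k≢to y = gate₂ {from y <? k} (dec-false (k Fin.≟ to k) k≢to)

  single-lower : ∀ k → toℕ (to k) ℕ.< toℕ k → single k ≈ (if k <? from k then t else r)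
  single-lower k to<k = eval (≤⇒<ᵇ≡false (ℕ.<⇒≤ to<k)) (<⇒<ᵇ≡true to<k)
    (dec-false (k Fin.≟ to k) λ eq → ℕ.<-irrefl (≡.cong toℕ (≡.sym eq)) to<k)
    where
    eval : ∀ {x y z A B} → x ≡ false → y ≡ true → z ≡ false →
      (if x then A else 1#) * (if y then B else 1#) * (if z then u else 1#) ≈ B
    eval ≡.refl ≡.refl ≡.refl = x*1 (*-identityˡ _) refl

  single-upper : ∀ k → toℕ k ℕ.< toℕ (to k) → single k ≈ (if from k <? k then s else p)
  single-upper k k<to = eval (<⇒<ᵇ≡true k<to) (≤⇒<ᵇ≡false (ℕ.<⇒≤ k<to))
    (dec-false (k Fin.≟ to k) λ eq → ℕ.<-irrefl (≡.cong toℕ eq) k<to)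
    where
    eval : ∀ {x y z A B} → x ≡ true → y ≡ false → z ≡ false →
      (if x then A else 1#) * (if y then B else 1#) * (if z then u else 1#) ≈ A
    eval ≡.refl ≡.refl ≡.refl = x*1 (*-identityʳ _) refl

  single-fixed : ∀ k → to k ≡ k → single k ≈ u
  single-fixed k eq = eval (≤⇒<ᵇ≡false (ℕ.≤-reflexive (≡.cong toℕ eq))) (≤⇒<ᵇ≡false (ℕ.≤-reflexive (≡.cong toℕ (≡.sym eq))))
    (dec-true (k Fin.≟ to k) (≡.sym eq))
    where
    eval : ∀ {x y z A B} → x ≡ false → y ≡ false → z ≡ true →
      (if x then A else 1#) * (if y then B else 1#) * (if z then u else 1#) ≈ u
    eval ≡.refl ≡.refl ≡.refl = 1*x (*-identityˡ _) refl

  -- The first l vertices of σ have been processed, and v translates the vertices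
  -- of the state S to those of σ.

  record Represents {l m} (S : State l m) (e : Fin m → Vertex l m) (v : Vertex l m → Fin n) :
                    Set (κ ⊔ κ′) where
    field
      position-low  : ∀ i → toℕ (v (inj₁ i)) ℕ.+ suc (toℕ i) ≡ l
      position-high : ∀ i → toℕ (v (inj₂ i)) ≡ l ℕ.+ toℕ i
      injective     : ∀ y z → v y ≡ v z → y ≡ z
      image         : ∀ i → to (v (inj₂ i)) ≡ v (e i)
      unused        : ∀ z → available S z ≡ not (toℕ (from (v z)) <ᵇ l)
      split         : ∀ (F : Fin n → Carrier) → ∏[ y < n ] F y ≈ ∏[ i < l ] F (v (inj₁ i)) * ∏[ i < m ] F (v (inj₂ i))

  module _ {l m} {low : Vec Bool l} {x} {high : Vec Bool m} {e : Fin (suc m) → Vertex l (suc m)}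
           {v : Vertex l (suc m) → Fin n} (rep : Represents (low , x ∷ high) e v) where

    open Represents rep

    private
      k : Fin n
      k = v (inj₂ zero)

      toℕ-k : toℕ k ≡ l
      toℕ-k = ≡.trans (position-high zero) (ℕ.+-identityʳ l)

      low<k : ∀ i → toℕ (v (inj₁ i)) ℕ.< toℕ k
      low<k i = ≡.subst (toℕ (v (inj₁ i)) ℕ.<_) (≡.trans (position-low i) (≡.sym toℕ-k)) (ℕ.m<m+n _ (ℕ.s≤s ℕ.z≤n))

      k<high : ∀ i → toℕ k ℕ.< toℕ (v (inj₂ (suc i)))
      k<high i = ≡.subst₂ ℕ._<_ (≡.sym toℕ-k) (≡.sym (position-high (suc i))) (ℕ.m<m+n l (ℕ.s≤s ℕ.z≤n))

      low-antitone : ∀ {i j} → i Fin.< j → toℕ (v (inj₁ j)) ℕ.< toℕ (v (inj₁ i))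
      low-antitone {i} {j} i<j = ℕ.+-cancelʳ-< (suc (toℕ j)) _ _
        (≡.subst (ℕ._< toℕ (v (inj₁ i)) ℕ.+ suc (toℕ j)) (≡.trans (position-low i) (≡.sym (position-low j)))
          (ℕ.+-monoʳ-< (toℕ (v (inj₁ i))) (ℕ.s<s i<j)))

      high-monotone : ∀ {i j} → i Fin.< j → toℕ (v (inj₂ (suc i))) ℕ.< toℕ (v (inj₂ (suc j)))
      high-monotone i<j = ≡.subst₂ ℕ._<_ (≡.sym (position-high _)) (≡.sym (position-high _)) (ℕ.+-monoʳ-< l (ℕ.s<s i<j))

      from<k : ∀ y → from y <? k ≡ (toℕ (from y) <ᵇ l)
      from<k y = ≡.cong (toℕ (from y) <ᵇ_) toℕ-k

      -- The hypothesis excludes that `k` is the preimage of `y`, so a preimage that is not before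
      -- `k` is after it.
      k<from : ∀ y → to k ≢ y → k <? from y ≡ not (toℕ (from y) <ᵇ l)
      k<from y to≢y = ≡.trans
        (<ᵇ-flip (toℕ (from y)) (toℕ k) λ eq → to≢y
          (≡.trans (≡.cong to (≡.sym (Fin.toℕ-injective eq))) (Perm.inverseʳ σ)))
        (≡.cong not (from<k y))

      high-bit : ∀ i → from (v (inj₂ i)) <? k ≡ lookup (x ∷ high) i
      high-bit i = ≡.trans (from<k _) (Bool.not-injective (≡.sym (unused (inj₂ i))))

      low-bit : ∀ i → to k ≢ v (inj₁ i) → k <? from (v (inj₁ i)) ≡ lookup low i
      low-bit i to≢ = ≡.trans (k<from _ to≢) (≡.sym (unused (inj₁ i)))

      <⇒≢ : ∀ {i j : Fin n} → toℕ i ℕ.< toℕ j → i ≢ j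
      <⇒≢ i<j eq = ℕ.<⇒≢ i<j (≡.cong toℕ eq)

    -- Only `lower` at processed vertices survives. As `low` is reversed, indices before `i` are
    -- vertices between the image and `k`, whose arcs cross; indices after `i` belong to enclosing
    -- arcs.
    local-low : ∀ i → to k ≡ v (inj₁ i) → local k ≈
      (if not x then t else r) * rank (if not x then f else h) (if not x then g else ℓ) low i
    local-low i eq = begin
      single k * ∏[ y < n ] upper k y * ∏[ y < n ] lower k y * ∏[ y < n ] fixed k y
        ≈⟨ x*1 (*-cong (x*1 (single-lower k to<k) (∏-≈1 n (upper-1 k (ℕ.<⇒≤ to<k)))) lowers)
               (∏-≈1 n (fixed-1 k (<⇒≢ to<k ∘ ≡.sym))) ⟩
      (if L then t else r) * rank (if L then f else h) (if L then g else ℓ) low i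
        ≡⟨ ≡.cong (λ L → (if L then t else r) * rank (if L then f else h) (if L then g else ℓ) low i) L≡ ⟩
      _ ∎
      where
      L : Bool
      L = k <? from k

      to<k : toℕ (to k) ℕ.< toℕ k
      to<k = ≡.subst (λ y → toℕ y ℕ.< toℕ k) (≡.sym eq) (low<k i)

      -- `k` is not a fixed point, so if its preimage is not smaller, it is larger.
      L≡ : L ≡ not x
      L≡ = ≡.trans (k<from k (<⇒≢ to<k)) (≡.sym (unused (inj₂ zero)))

      lowers : ∏[ y < n ] lower k y ≈ rank (if L then f else h) (if L then g else ℓ) low i
      lowers = trans (split (lower k)) (x*1
        (∏-rank _ _ low i _ before (1*1 (gate₁ (≤⇒<ᵇ≡false (ℕ.≤-reflexive (≡.cong toℕ eq))))
                                        (gate₁ (≤⇒<ᵇ≡false (ℕ.≤-reflexive (≡.cong toℕ (≡.sym eq))))))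
          after)
        (∏-≈1 (suc m) beyond))
        where
        before : ∀ j → j Fin.< i → lower k (v (inj₁ j)) ≈ (if lookup low j then (if L then g else ℓ) else 1#)
        before j j<i = 1*x (gate₁ (≤⇒<ᵇ≡false (ℕ.<⇒≤ to<y)))
          (gate-on₃ (<⇒<ᵇ≡true to<y) (<⇒<ᵇ≡true (low<k j)) (low-bit j (<⇒≢ to<y)))
          where
          to<y : toℕ (to k) ℕ.< toℕ (v (inj₁ j))
          to<y = ≡.subst (λ y → toℕ y ℕ.< _) (≡.sym eq) (low-antitone j<i)

        after : ∀ j → i Fin.< j → lower k (v (inj₁ j)) ≈ (if lookup low j then (if L then f else h) else 1#)
        after j i<j = x*1
          (gate-on₃ (<⇒<ᵇ≡true y<to) (<⇒<ᵇ≡true to<k) (low-bit j (<⇒≢ y<to ∘ ≡.sym)))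
          (gate₁ (≤⇒<ᵇ≡false (ℕ.<⇒≤ y<to)))
          where
          y<to : toℕ (v (inj₁ j)) ℕ.< toℕ (to k)
          y<to = ≡.subst (λ y → _ ℕ.< toℕ y) (≡.sym eq) (low-antitone i<j)

        beyond : ∀ j → lower k (v (inj₂ j)) ≈ 1#
        beyond j = 1*1 (gate₁ (≤⇒<ᵇ≡false (ℕ.≤-trans (ℕ.<⇒≤ to<k) k≤y))) (gate₂ {to k <? y} (≤⇒<ᵇ≡false k≤y))
          where
          y : Fin n
          y = v (inj₂ j)

          k≤y : toℕ k ℕ.≤ toℕ y
          k≤y = ≡.subst₂ ℕ._≤_ (≡.sym toℕ-k) (≡.sym (position-high j)) (ℕ.m≤m+n l _)

    -- The arcs over a fixed point end at the used vertices to its right, each giving one factor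
    -- `w`.
    local-fixed : to k ≡ k → local k ≈ u * w ^ ∣ high ∣
    local-fixed eq = *-cong
      (x*1 (x*1 (single-fixed k eq) (∏-≈1 n (upper-1 k to≤k))) (∏-≈1 n (lower-1 k k≤to)))
      (trans (split (fixed k)) (1*x
        (∏-≈1 l λ i → gate₃ {from _ <? k} {k ≟ to k} (≤⇒<ᵇ≡false (ℕ.≤-trans (ℕ.<⇒≤ (low<k i)) k≤to)))
        (1*x (gate₃ {from k <? k} {k ≟ to k} (≤⇒<ᵇ≡false k≤to))
             (∏-power w high _ λ i → gate-on₁ (high-bit (suc i)) (dec-true (k Fin.≟ to k) (≡.sym eq))
               (<⇒<ᵇ≡true (ℕ.≤-<-trans to≤k (k<high i)))))))
      where
      to≤k : toℕ (to k) ℕ.≤ toℕ k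
      to≤k = ℕ.≤-reflexive (≡.cong toℕ eq)

      k≤to : toℕ k ℕ.≤ toℕ (to k)
      k≤to = ℕ.≤-reflexive (≡.cong toℕ (≡.sym eq))

    local-high : ∀ i → to k ≡ v (inj₂ (suc i)) → local k ≈
      (if x then s else p) * rank (if x then a else c) (if x then b else d) high i
    local-high i eq = begin
      single k * ∏[ y < n ] upper k y * ∏[ y < n ] lower k y * ∏[ y < n ] fixed k y
        ≈⟨ x*1 (x*1 (*-cong (single-upper k k<to) uppers) (∏-≈1 n (lower-1 k (ℕ.<⇒≤ k<to))))
               (∏-≈1 n (fixed-1 k (<⇒≢ k<to))) ⟩
      (if L then s else p) * rank (if L then a else c) (if L then b else d) high i
        ≡⟨ ≡.cong (λ L → (if L then s else p) * rank (if L then a else c) (if L then b else d) high i) (high-bit zero) ⟩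
      _ ∎
      where
      L : Bool
      L = from k <? k

      k<to : toℕ k ℕ.< toℕ (to k)
      k<to = ≡.subst (λ y → toℕ k ℕ.< toℕ y) (≡.sym eq) (k<high i)

      uppers : ∏[ y < n ] upper k y ≈ rank (if L then a else c) (if L then b else d) high i
      uppers = trans (split (upper k)) (1*x
        (∏-≈1 l λ j → processed (v (inj₁ j)) (ℕ.<⇒≤ (low<k j)))
        (1*x (processed k ℕ.≤-refl)
          (∏-rank _ _ high i _ before
            (1*1 (gate₃ {from _ <? k} {k <? to k} (≤⇒<ᵇ≡false (ℕ.≤-reflexive (≡.cong toℕ (≡.sym eq)))))
                 (gate₃ {from _ <? k} {k <? v (inj₂ (suc i))} (≤⇒<ᵇ≡false (ℕ.≤-reflexive (≡.cong toℕ eq)))))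
            after)))
        where
        processed : ∀ y → toℕ y ℕ.≤ toℕ k → upper k y ≈ 1#
        processed y y≤k = 1*1
          (gate₃ {from y <? k} {k <? to k} (≤⇒<ᵇ≡false (ℕ.≤-trans y≤k (ℕ.<⇒≤ k<to))))
          (gate₂ {from y <? k} (≤⇒<ᵇ≡false y≤k))

        before : ∀ j → j Fin.< i → upper k (v (inj₂ (suc j))) ≈ (if lookup high j then (if L then b else d) else 1#)
        before j j<i = 1*x
          (gate₃ {from _ <? k} {k <? to k} (≤⇒<ᵇ≡false (ℕ.<⇒≤ y<to)))
          (gate-on₁ (high-bit (suc j)) (<⇒<ᵇ≡true (k<high j)) (<⇒<ᵇ≡true y<to))
          where
          y<to : toℕ (v (inj₂ (suc j))) ℕ.< toℕ (to k)
          y<to = ≡.subst (λ y → _ ℕ.< toℕ y) (≡.sym eq) (high-monotone j<i)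

        after : ∀ j → i Fin.< j → upper k (v (inj₂ (suc j))) ≈ (if lookup high j then (if L then a else c) else 1#)
        after j i<j = x*1
          (gate-on₁ (high-bit (suc j)) (<⇒<ᵇ≡true k<to) (<⇒<ᵇ≡true to<y))
          (gate₃ {from _ <? k} {k <? v (inj₂ (suc j))} (≤⇒<ᵇ≡false (ℕ.<⇒≤ to<y)))
          where
          to<y : toℕ (to k) ℕ.< toℕ (v (inj₂ (suc j)))
          to<y = ≡.subst (λ y → toℕ y ℕ.< _) (≡.sym eq) (high-monotone i<j)

    local-weight : local k ≈ weight (low , x ∷ high) (e zero)
    local-weight = at (e zero) (image zero)
      where
      weight-low : ∀ x i → (if not x then t else r) * rank (if not x then f else h) (if not x then g else ℓ) low i ≈
                           weight (low , x ∷ high) (inj₁ i)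
      weight-low true  i = refl
      weight-low false i = refl

      weight-high : ∀ x i → (if x then s else p) * rank (if x then a else c) (if x then b else d) high i ≈
                            weight (low , x ∷ high) (inj₂ (suc i))
      weight-high true  i = refl
      weight-high false i = refl

      weight-fixed : ∀ x → u * w ^ ∣ high ∣ ≈ weight (low , x ∷ high) (inj₂ zero)
      weight-fixed true  = refl
      weight-fixed false = refl

      at : ∀ z → to k ≡ v z → local k ≈ weight (low , x ∷ high) z
      at (inj₁ i)       eq = trans (local-low i eq) (weight-low x i)
      at (inj₂ zero)    eq = trans (local-fixed eq) (weight-fixed x)
      at (inj₂ (suc i)) eq = trans (local-high i eq) (weight-high x i)

    represents-choose : Represents (choose (low , x ∷ high) (e zero)) (shift ∘ e ∘ suc) (v ∘ unshift)
    represents-choose = record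
      { position-low  = λ where
          zero    → ≡.trans (≡.cong (ℕ._+ 1) toℕ-k) (ℕ.+-comm l 1)
          (suc i) → ≡.trans (ℕ.+-suc _ _) (≡.cong suc (position-low i))
      ; position-high = λ i → ≡.trans (position-high (suc i)) (ℕ.+-suc l (toℕ i))
      ; injective     = λ y z eq → ≡.trans (≡.sym (shift-unshift y))
                          (≡.trans (≡.cong shift (injective _ _ eq)) (shift-unshift z))
      ; image         = λ i → ≡.trans (image (suc i)) (≡.cong v (≡.sym (unshift-shift (e (suc i)))))
      ; unused        = λ z → ≡.subst
                          (λ z′ → available (choose S (e zero)) z′ ≡ not (toℕ (from (v (unshift z))) <ᵇ suc l))
                          (shift-unshift z) (unused′ (unshift z))
      ; split         = λ F → trans (split F)
                          (trans (sym (*-assoc _ _ _)) (*-congʳ (*-comm _ _)))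
      }
      where
      S : State l (suc m)
      S = low , x ∷ high

      -- Raising the bound from l to l + 1 affects only the vertex whose preimage is the current
      -- one, which is the chosen image.
      unused′ : ∀ z → available (choose S (e zero)) (shift z) ≡ not (toℕ (from (v z)) <ᵇ suc l)
      unused′ z with Sum.≡-dec Fin._≟_ Fin._≟_ z (e zero)
      ... | yes ≡.refl = ≡.trans (available-choose-≡ S (e zero)) (≡.cong not (≡.sym
        (≡.trans (≡.cong (_<ᵇ suc l) position) (<ᵇ-suc-≡ l))))
        where
        position : toℕ (from (v (e zero))) ≡ l
        position = ≡.trans (≡.cong toℕ (≡.trans (≡.cong from (≡.sym (image zero))) (Perm.inverseˡ σ))) toℕ-k
      ... | no  z≢e = ≡.trans (available-choose-≢ S z (e zero) z≢e) (≡.trans (unused z)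
        (≡.cong not (≡.sym (<ᵇ-suc-≢ _ _ λ eq → z≢e (injective _ _ (same eq))))))
        where
        same : toℕ (from (v z)) ≡ l → v z ≡ v (e zero)
        same eq = ≡.trans (≡.sym (Perm.inverseʳ σ))
          (≡.trans (≡.cong to (Fin.toℕ-injective (≡.trans eq (≡.sym toℕ-k)))) (image zero))

  ∏-local : ∀ {l} m {S : State l m} {e v} → Represents S e v →
            ∏[ i < m ] local (v (inj₂ i)) ≈ wordWeight m S e
  ∏-local zero    rep = refl
  ∏-local (suc m) {low , x ∷ high} rep = *-cong (local-weight rep) (∏-local m (represents-choose rep))

  initial-represents : Represents (initial n) (inj₂ ∘ to) λ { (inj₂ i) → i }
  initial-represents = record
    { position-low  = λ ()
    ; position-high = λ _ → ≡.refl
    ; injective     = λ { (inj₂ i) (inj₂ j) eq → ≡.cong inj₂ eq }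
    ; image         = λ _ → ≡.refl
    ; unused        = λ { (inj₂ i) → ≡.cong not (Vec.lookup-replicate i false) }
    ; split         = λ F → sym (*-identityˡ _)
    }

  monomial≈wordWeight : monomial ≈ wordWeight n (initial n) (inj₂ ∘ to)
  monomial≈wordWeight = trans monomial≈∏-local (∏-local n initial-represents)

theorem1 : ∀ {κ κ′} (R : CommutativeRing κ κ′) →
    let open CommutativeRing R
        open PowerSeries R
    in (a b c d f g h ℓ p r s t u w : Carrier) →
       jFraction
         (λ n → u * w ^ n + s * [ n ]⟨ a , b ⟩ + t * [ n ]⟨ f , g ⟩)
         (λ n → p * r * [ n ]⟨ c , d ⟩ * [ n ]⟨ h , ℓ ⟩)
       ≋
       λ n → ∑[ σ ∈ permutations n ]
         ( a ^ ile σ * b ^ nile σ * c ^ (ie σ ∸ ile σ) * d ^ (nie σ ∸ nile σ)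
         * f ^ ilae σ * g ^ nilae σ * h ^ (iae σ ∸ ilae σ) * ℓ ^ (niae σ ∸ nilae σ)
         * p ^ (exc σ ∸ le σ) * r ^ (aexc σ ∸ lae σ) * s ^ le σ * t ^ lae σ
         * u ^ fp σ * w ^ iefp σ )
theorem1 R a b c d f g h ℓ p r s t u w n = begin
  _ ≈⟨ ∑-wordWeight≈jFraction n ⟨
  _ ≈⟨ ∑∈-cong (permutations n) (λ σ → monomial≈wordWeight σ) ⟨
  _ ∎
  where
  open CommutativeRing R
  open SetoidReasoning setoid
  open ListSums R
  open PermutationSums R a b c d f g h ℓ p r s t u w
  open MonomialWeights R a b c d f g h ℓ p r s t u w
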